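{- The exponential generating function $\mathsf{F}(t)=\sum_{n=0}^\infty \mathcal{F}_n\frac{t^n}{n!}$ of the Fibonacci-Fubini numbers is given by $$\mathsf{F}(t)= \frac{1}{\sqrt{5}}\left(\alpha e^{\left(e^{t}-1\right)\alpha}-\beta e^{\left(e^{t}-1\right)\beta}\right).$$
   Context: $\alpha=(1+\sqrt5)/2$ and $\beta=(1-\sqrt5)/2$. The identity is one of formal power series in $t$. A permutation $\sigma=\sigma_1\cdots\sigma_k$ of $\{1,\dots,k\}$ is a Fibonacci permutation if $|\sigma_i-i|\le 1$ for every $i$. For a set partition of $[n]=\{1,\dots,n\}$ into non-empty blocks $B_1|B_2|\cdots|B_k$, the blocks are always listed so that $\min B_1<\min B_2<\cdots<\min B_k$. A Fibonacci ordered partition of $[n]$ is an arrangement $B_{\sigma_1}|B_{\sigma_2}|\cdots|B_{\sigma_k}$ where $B_1|\cdots|B_k$ is a partition of $[n]$ (any number $k$ of blocks) and $\sigma$ is a Fibonacci permutation of $\{1,\dots,k\}$. The Fibonacci-Fubini number $\mathcal{F}_n$ is the total number of Fibonacci ordered partitions of $[n]$ (for $n=0$ the empty partition with $k=0$ blocks is counted once, so $\mathcal{F}_0=1$). -}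

module Defs where

open import Algebra.Bundles.Raw using (RawRing)
import Algebra.Definitions.RawSemiring as RawSemiringDefinitions
import Data.Bool.Properties as Bool
open import Data.Fin.Base as Fin using (Fin; toℕ)
import Data.Fin.Properties as Fin
open import Data.Fin.Subset
  using (Subset; inside; outside; _∈_; Nonempty; Empty; _∩_)
open import Data.Fin.Subset.Properties using (_∈?_; nonempty?; x∈p∩q⁺)
open import Data.Integer.Base using (+_)
open import Data.List.Base as List
  using (List; []; _∷_; allFin; cartesianProductWith; concatMap; deduplicate; filter; length; upTo)
open import Data.List.Membership.Propositional using () renaming (_∈_ to _∈ˡ_)
open import Data.List.Membership.Propositional.Properties
  using ( ∈-allFin; ∈-filter⁺; ∈-filter⁻; ∈-concatMap⁺; ∈-concatMap⁻
        ; ∈-cartesianProductWith⁺; ∈-cartesianProductWith⁻; ∈-upTo⁺ )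
import Data.List.Properties as List
open import Data.List.Relation.Unary.Any as Any using (here; there)
open import Data.Nat.Base using (ℕ; zero; suc; _≤_; _<_; s≤s; _∸_; _!; ∣_-_∣)
open import Data.Nat.Properties using (_≤?_; _<?_; _!≢0)
open import Data.Product.Base using (Σ; ∃; _×_; _,_; proj₁; proj₂)
open import Data.Rational.Base as ℚ using (ℚ; 0ℚ; 1ℚ; ½)
import Data.Rational.Properties as ℚ
open import Data.Vec.Base as Vec using (Vec; []; _∷_; lookup; toList)
import Data.Vec.Properties as Vec
open import Function.Base using (_∘_)
open import Function.Bundles using (_⇔_; mk⇔)
open import Function.Consequences.Propositional
  using (strictlySurjective⇒surjective; surjective⇒strictlySurjective)
open import Function.Definitions using (Bijective)
open import Relation.Binary.PropositionalEquality
  using (_≡_; _≢_; refl; sym; subst; cong₂)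
open import Relation.Nullary.Decidable
  using (Dec; decidable-stable; map′; ¬?; _×-dec_; _→-dec_)

private
  variable
    n k : ℕ

-- The set [n] = {1, …, n} is represented by Fin n.

-- The position of the least element; the value n on the empty subset is
-- never used, as blocks are nonempty.
min : Subset n → ℕ
min []            = 0
min (inside  ∷ p) = 0
min (outside ∷ p) = suc (min p)

record IsSetPartition {n k} (B : Vec (Subset n) k) : Set where
  constructor mkIsSetPartition
  field
    nonempty : ∀ i → Nonempty (lookup B i)
    disjoint : ∀ i j → i ≢ j → Empty (lookup B i ∩ lookup B j)
    cover    : ∀ x → ∃ λ i → x ∈ lookup B i
    ordered  : ∀ i j → i Fin.< j → min (lookup B i) < min (lookup B j)

-- σ is in one-line notation.
record IsFibonacciPermutation {k} (σ : Vec (Fin k) k) : Set where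
  constructor mkIsFibonacciPermutation
  field
    bijective : Bijective _≡_ _≡_ (lookup σ)
    near      : ∀ i → ∣ toℕ (lookup σ i) - toℕ i ∣ ≤ 1

-- B_{σ₁} | B_{σ₂} | ⋯ | B_{σₖ}
arrange : Vec (Subset n) k → Vec (Fin k) k → List (Subset n)
arrange B σ = toList (Vec.map (lookup B) σ)

IsFibonacciOrderedPartition : List (Subset n) → Set
IsFibonacciOrderedPartition {n} A =
  ∃ λ k → Σ (Vec (Subset n) k) λ B → Σ (Vec (Fin k) k) λ σ →
    IsSetPartition B × IsFibonacciPermutation σ × A ≡ arrange B σ

isSetPartition? : (B : Vec (Subset n) k) → Dec (IsSetPartition B)
isSetPartition? B = map′
  (λ (a , b , c , d) → mkIsSetPartition a b c d)
  (λ p → let open IsSetPartition p in nonempty , disjoint , cover , ordered)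
  (     Fin.all? (λ i → nonempty? (lookup B i))
  ×-dec Fin.all? (λ i → Fin.all? λ j →
          ¬? (i Fin.≟ j) →-dec ¬? (nonempty? (lookup B i ∩ lookup B j)))
  ×-dec Fin.all? (λ x → Fin.any? λ i → x ∈? lookup B i)
  ×-dec Fin.all? (λ i → Fin.all? λ j →
          (i Fin.<? j) →-dec (min (lookup B i) <? min (lookup B j))))

isFibonacciPermutation? : (σ : Vec (Fin k) k) → Dec (IsFibonacciPermutation σ)
isFibonacciPermutation? σ = map′
  (λ (inj , surj , near) → mkIsFibonacciPermutation
    ((λ {i} {j} → inj i j) , strictlySurjective⇒surjective surj) near)
  (λ p → let open IsFibonacciPermutation p in
    (λ i j → proj₁ bijective) , surjective⇒strictlySurjective (proj₂ bijective) , near)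
  (     Fin.all? (λ i → Fin.all? λ j → (lookup σ i Fin.≟ lookup σ j) →-dec (i Fin.≟ j))
  ×-dec Fin.all? (λ j → Fin.any? λ i → lookup σ i Fin.≟ j)
  ×-dec Fin.all? (λ i → ∣ toℕ (lookup σ i) - toℕ i ∣ ≤? 1))

vectors : {A : Set} → List A → ∀ k → List (Vec A k)
vectors xs zero    = [] ∷ []
vectors xs (suc k) = cartesianProductWith _∷_ xs (vectors xs k)

setPartitions : ∀ n k → List (Vec (Subset n) k)
setPartitions n k =
  filter isSetPartition? (vectors (vectors (inside ∷ outside ∷ []) n) k)

fibonacciPermutations : ∀ k → List (Vec (Fin k) k)
fibonacciPermutations k = filter isFibonacciPermutation? (vectors (allFin k) k)

-- A partition of [n] has at most n blocks.
fibonacciOrderedPartitions : ∀ n → List (List (Subset n))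
fibonacciOrderedPartitions n = concatMap
  (λ k → cartesianProductWith arrange (setPartitions n k) (fibonacciPermutations k))
  (upTo (suc n))

fibonacciFubini : ℕ → ℕ
fibonacciFubini n = length
  (deduplicate (List.≡-dec (Vec.≡-dec Bool._≟_)) (fibonacciOrderedPartitions n))

∈-vectors : {A : Set} {xs : List A} → (∀ x → x ∈ˡ xs) → (v : Vec A k) → v ∈ˡ vectors xs k
∈-vectors all []      = here refl
∈-vectors all (x ∷ v) = ∈-cartesianProductWith⁺ _∷_ (all x) (∈-vectors all v)

#blocks≤n : {B : Vec (Subset n) k} → IsSetPartition B → k ≤ n
#blocks≤n {B = B} p = Fin.injective⇒≤ {f = proj₁ ∘ nonempty} λ {i} {j} eq →
  decidable-stable (i Fin.≟ j) λ i≢j →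
    disjoint i j i≢j (_ , x∈p∩q⁺
      (proj₂ (nonempty i) , subst (_∈ lookup B j) (sym eq) (proj₂ (nonempty j))))
  where open IsSetPartition p

∈-fibonacciOrderedPartitions : (A : List (Subset n)) →
  A ∈ˡ fibonacciOrderedPartitions n ⇔ IsFibonacciOrderedPartition A
∈-fibonacciOrderedPartitions {n} A = mk⇔ sound complete
  where
  all-subsets : (p : Subset n) → p ∈ˡ vectors (inside ∷ outside ∷ []) n
  all-subsets = ∈-vectors λ { inside → here refl ; outside → there (here refl) }

  arrangements : ℕ → List (List (Subset n))
  arrangements k = cartesianProductWith arrange (setPartitions n k) (fibonacciPermutations k)

  sound : A ∈ˡ fibonacciOrderedPartitions n → IsFibonacciOrderedPartition A
  sound A∈ with Any.satisfied (∈-concatMap⁻ arrangements {xs = upTo (suc n)} A∈)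
  ... | k , A∈k
    with ∈-cartesianProductWith⁻ arrange (setPartitions n k) (fibonacciPermutations k) A∈k
  ... | B , σ , B∈ , σ∈ , eq =
    k , B , σ , proj₂ (∈-filter⁻ isSetPartition? {xs = vectors _ k} B∈)
              , proj₂ (∈-filter⁻ isFibonacciPermutation? {xs = vectors _ k} σ∈) , eq

  complete : IsFibonacciOrderedPartition A → A ∈ˡ fibonacciOrderedPartitions n
  complete (k , B , σ , pB , pσ , refl) =
    ∈-concatMap⁺ arrangements (Any.map (λ { refl → A∈k }) (∈-upTo⁺ (s≤s (#blocks≤n pB))))
    where
    A∈k : A ∈ˡ arrangements k
    A∈k = ∈-cartesianProductWith⁺ arrange
      (∈-filter⁺ isSetPartition? (∈-vectors all-subsets B) pB)
      (∈-filter⁺ isFibonacciPermutation? (∈-vectors ∈-allFin σ) pσ)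

-- All coefficients of the identity lie in the subfield ℚ(√5) of ℝ;
-- a +√5· b stands for a + b√5.
record ℚ√5 : Set where
  constructor _+√5·_
  field
    rat  : ℚ
    surd : ℚ

ℚ√5-rawRing : RawRing _ _
ℚ√5-rawRing = record
  { Carrier = ℚ√5
  ; _≈_     = _≡_
  ; _+_     = λ { (a +√5· b) (c +√5· d) → (a ℚ.+ c) +√5· (b ℚ.+ d) }
  ; _*_     = λ { (a +√5· b) (c +√5· d) →
                  (a ℚ.* c ℚ.+ (+ 5 ℚ./ 1) ℚ.* (b ℚ.* d)) +√5· (a ℚ.* d ℚ.+ b ℚ.* c) }
  ; -_      = λ { (a +√5· b) → (ℚ.- a) +√5· (ℚ.- b) }
  ; 0#      = 0ℚ +√5· 0ℚ
  ; 1#      = 1ℚ +√5· 0ℚ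
  }

module _ where
  open RawRing ℚ√5-rawRing using (_+_; _*_; -_; 1#)

  fromℚ : ℚ → ℚ√5
  fromℚ q = q +√5· 0ℚ

  √5 : ℚ√5
  √5 = 0ℚ +√5· 1ℚ

  1/√5 : ℚ√5
  1/√5 = 0ℚ +√5· (+ 1 ℚ./ 5)

  √5*√5≡5 : √5 * √5 ≡ fromℚ (+ 5 ℚ./ 1)
  √5*√5≡5 = refl

  √5*1/√5≡1 : √5 * 1/√5 ≡ 1#
  √5*1/√5≡1 = refl

  α β : ℚ√5
  α = fromℚ ½ * (1# + √5)
  β = fromℚ ½ * (1# + (- √5))

module PowerSeries {c ℓ} (R : RawRing c ℓ) where
  private
    module R where
      open RawRing R public
      open RawSemiringDefinitions rawSemiring public using (sum)

  -- A power series is its sequence of coefficients.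
  rawRing : RawRing _ _
  rawRing = record
    { Carrier = ℕ → R.Carrier
    ; _≈_     = λ f g → ∀ n → f n R.≈ g n
    ; _+_     = λ f g n → f n R.+ g n
    ; _*_     = λ f g n → R.sum {suc n} λ i → f (toℕ i) R.* g (n ∸ toℕ i)
    ; -_      = λ f n → R.- f n
    ; 0#      = λ n → R.0#
    ; 1#      = λ { zero → R.1# ; (suc n) → R.0# }
    }

  open RawRing rawRing public renaming (Carrier to Series)
  open RawSemiringDefinitions rawSemiring public using (_^_)

  infixl 6 _-_
  _-_ : Series → Series → Series
  f - g = f + (- g)

  infixr 7 _•_
  _•_ : R.Carrier → Series → Series
  (a • f) n = a R.* f n

  -- Substitution Σₖ fₖ gᵏ, meaningful only when g has zero constant term:
  -- then gᵏ does not contribute to the coefficient of tⁿ for k > n.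
  infixr 9 _⟨_⟩
  _⟨_⟩ : Series → Series → Series
  (f ⟨ g ⟩) n = R.sum {suc n} λ k → f (toℕ k) R.* (g ^ toℕ k) n

open PowerSeries ℚ√5-rawRing public

egf : (ℕ → ℕ) → Series
egf a n = fromℚ ((+ a n) ℚ./ (n !))
  where instance _ = n !≢0

exp : Series
exp = egf λ _ → 1

exp-1-constant-term : ∀ a → (a • (exp - 1#)) 0 ≡ fromℚ 0ℚ
exp-1-constant-term (a +√5· b) = cong₂ _+√5·_
  (cong₂ (λ x y → x ℚ.+ (+ 5 ℚ./ 1) ℚ.* y) (ℚ.*-zeroʳ a) (ℚ.*-zeroʳ b))
  (cong₂ ℚ._+_ (ℚ.*-zeroʳ a) (ℚ.*-zeroʳ b))

{-# OPTIONS --safe #-}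
module Submission where

-- An arrangement determines its blocks and their order, so 𝓕ₙ = Σₖ S(n,k) fₖ with
-- S(n,k) the Stirling numbers of the second kind and fₖ = Fₖ₊₁ the number of
-- Fibonacci permutations.  Fibonacci permutations either fix 1 or swap 1 and 2.
-- Partitions are built by inserting a new least element: it joins one of the j
-- blocks already begun or begins the next one, which gives numbers
-- satisfying the Stirling recurrence.  On the analytic side, E = eᵗ − 1 satisfies
-- (Eᵏ⁺¹)′ = (k+1)(Eᵏ⁺¹ + Eᵏ), the same recurrence for the coefficients n! [tⁿ] Eᵏ / k!,
-- and Binet's formula turns (αᵏ⁺¹ − βᵏ⁺¹)/√5 into fₖ.

open import Algebra.Bundles using (CommutativeRing)
open import Algebra.Bundles.Raw using (RawRing)
open import Algebra.Consequences.Propositional using (comm∧idˡ⇒id; comm∧invˡ⇒inv; comm∧distrˡ⇒distr)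
open import Algebra.Definitions using (Commutative)
import Algebra.Properties.CommutativeMonoid.Mult
import Algebra.Properties.CommutativeMonoid.Sum
import Algebra.Properties.Monoid.Sum
import Algebra.Properties.Ring
import Algebra.Properties.Semiring.Exp
import Algebra.Properties.Semiring.Mult
import Algebra.Properties.Semiring.Sum
import Algebra.Solver.Ring.NaturalCoefficients.Default
open import Algebra.Structures using (IsCommutativeRing)
import Data.Bool.Properties as Bool
open import Data.Fin.Base as Fin using (Fin; zero; suc; toℕ; fromℕ<; inject₁)
import Data.Fin.Properties as Fin
open import Data.Fin.Subset using (Subset; inside; outside; _∈_; Nonempty; Empty; _∩_; ⁅_⁆)
open import Data.Fin.Subset.Properties using (x∈p∩q⁺; x∈p∩q⁻; x∈⁅x⁆; x∈⁅y⁆⇒x≡y)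
open import Data.Integer.Base as ℤ using (+_)
import Data.Integer.Properties as ℤ
open import Data.List.Base
  using (List; []; _∷_; _++_; allFin; applyUpTo; concat; concatMap; deduplicate; length; map; tabulate; upTo)
open import Data.List.Membership.Propositional using () renaming (_∈_ to _∈ˡ_)
open import Data.List.Membership.Propositional.Properties
  using ( ∈-map⁺; ∈-map⁻; ∈-++⁺ˡ; ∈-++⁺ʳ; ∈-++⁻; ∈-concatMap⁺; ∈-allFin; ∈-upTo⁺
        ; ∈-deduplicate⁺; ∈-deduplicate⁻ )
open import Data.List.Membership.Propositional.Properties.WithK using (unique∧set⇒bag)
import Data.List.Properties as List
open import Data.List.Relation.Binary.BagAndSetEquality using (∼bag⇒↭)
open import Data.List.Relation.Binary.Permutation.Propositional.Properties using (↭-length)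
open import Data.List.Relation.Unary.All as All using ([]; _∷_)
import Data.List.Relation.Unary.All.Properties as All
open import Data.List.Relation.Unary.AllPairs using ([]; _∷_)
open import Data.List.Relation.Unary.Any as Any using (here; there)
open import Data.List.Relation.Unary.Unique.Propositional using (Unique)
import Data.List.Relation.Unary.Unique.DecPropositional.Properties as Unique
import Data.List.Relation.Unary.Unique.Propositional.Properties as Unique
open import Data.Nat.Base as ℕ
  using (ℕ; zero; suc; _≤_; _<_; _∸_; _!; ∣_-_∣; z≤n; s≤s; z<s; s<s; s<s⁻¹)
import Data.Nat.ListAction as ℕ
import Data.Nat.Properties as ℕ
open import Data.Nat.Tactic.RingSolver using (solve-∀)
open import Data.Product.Base using (∃; ∃₂; _,_; proj₁; proj₂)
open import Data.Rational.Base as ℚ using (ℚ; 0ℚ; 1ℚ)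
import Data.Rational.Properties as ℚ
import Data.Rational.Solver as ℚ
import Data.Rational.Unnormalised.Base as ℚᵘ
import Data.Rational.Unnormalised.Properties as ℚᵘ
open import Data.Sum.Base using (_⊎_; inj₁; inj₂)
open import Data.Vec.Base as Vec using (Vec; []; _∷_; lookup; toList; zipWith; replicate)
import Data.Vec.Properties as Vec
open import Function.Base using (_∘_; id)
open import Function.Bundles using (_⇔_; mk⇔; Equivalence)
open import Function.Consequences.Propositional
  using (strictlySurjective⇒surjective; surjective⇒strictlySurjective)
open import Relation.Binary.Definitions using (tri<; tri≈; tri>)
open import Relation.Binary.PropositionalEquality as ≡
  using (_≡_; _≢_; cong; cong₂; subst; subst₂; module ≡-Reasoning)
open import Relation.Binary.PropositionalEquality.Algebra using (isMagma)
import Relation.Binary.Reasoning.Setoid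
open import Relation.Nullary using (yes; no; contradiction)

open import Defs using
  ( min; arrange; fibonacciFubini; fibonacciOrderedPartitions; ∈-fibonacciOrderedPartitions
  ; IsFibonacciOrderedPartition; #blocks≤n; IsSetPartition; mkIsSetPartition
  ; IsFibonacciPermutation; mkIsFibonacciPermutation; module PowerSeries )

-- A subset of `Fin (suc n)` carries the entry of its least element at the head, so induction on n
-- strips the minimum. What remains need not be a set partition: the stripped element may have been
-- alone in its block, and it alone fixed the rank of that block. The number j of blocks begun so
-- far records which rows are excused from being nonempty and ordered. The price is a recursion that
-- changes j, whereas the Stirling recurrence removes the largest element; passing from one to the
-- other is a separate induction on numbers. `fibonacciFubini` deduplicates an exhaustive search, so
-- its value is found by counting another duplicate-free list with the same members. Coefficients
-- are compared after multiplication by n!, as natural multiples of 1. The power series argument is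
-- thereby valid over every commutative ring; division is needed only in ℚ(√5), to relate `exp` to
-- the factorials and to cancel n!.

module _ where
  open import Data.Nat.Base using (_+_; _*_)
  open import Data.Product.Base using (_×_)
  open ≡ using (refl; sym; trans)

  stirling₂ : ℕ → ℕ → ℕ
  stirling₂ zero    zero    = 1
  stirling₂ zero    (suc k) = 0
  stirling₂ (suc n) zero    = 0
  stirling₂ (suc n) (suc k) = suc k * stirling₂ n (suc k) + stirling₂ n k

  -- Indexed so that fib k is the Fibonacci number Fₖ₊₁.
  fib : ℕ → ℕ
  fib zero          = 1
  fib (suc zero)    = 1
  fib (suc (suc k)) = fib (suc k) + fib k

  private variable
    A C : Set
    n k : ℕ

  -- Duplicate-free lists and lengths of concatenations

  map-unique : {f : A → C} {xs : List A} → Unique xs →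
    (∀ {x y} → x ∈ˡ xs → y ∈ˡ xs → f x ≡ f y → x ≡ y) → Unique (map f xs)
  map-unique []       inj = []
  map-unique {xs = x ∷ xs} (x∉ ∷ u) inj =
    All.map⁺ (All.tabulate λ y∈ eq → All.lookup x∉ y∈ (inj (here refl) (there y∈) eq))
    ∷ map-unique u λ p q → inj (there p) (there q)

  ∈-concatMap : {f : A → List C} {xs : List A} {x : A} {z : C} → x ∈ˡ xs → z ∈ˡ f x → z ∈ˡ concatMap f xs
  ∈-concatMap {f = f} {z = z} x∈ z∈ = ∈-concatMap⁺ f (Any.map (λ eq → subst (λ x → z ∈ˡ f x) eq z∈) x∈)

  ∈-concatMap⇒∃ : {f : A → List C} (xs : List A) {z : C} → z ∈ˡ concatMap f xs → ∃ λ x → x ∈ˡ xs × z ∈ˡ f x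
  ∈-concatMap⇒∃ {f = f} (x ∷ xs) z∈ with ∈-++⁻ (f x) z∈
  ... | inj₁ p = x , here refl , p
  ... | inj₂ p = let y , y∈ , q = ∈-concatMap⇒∃ xs p in y , there y∈ , q

  concatMap-unique : {f : A → List C} {xs : List A} → Unique xs →
    (∀ {x} → x ∈ˡ xs → Unique (f x)) →
    (∀ {x y z} → x ∈ˡ xs → y ∈ˡ xs → z ∈ˡ f x → z ∈ˡ f y → x ≡ y) →
    Unique (concatMap f xs)
  concatMap-unique [] _ _ = []
  concatMap-unique {xs = x ∷ xs} (x∉ ∷ u) uf disj = Unique.++⁺ (uf (here refl))
    (concatMap-unique u (uf ∘ there) λ p q → disj (there p) (there q))
    λ (z∈fx , z∈) → let y , y∈ , z∈fy = ∈-concatMap⇒∃ xs z∈ in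
      All.lookup x∉ y∈ (disj (here refl) (there y∈) z∈fx z∈fy)

  length-concatMap-const : ∀ {f : A → List C} {c} → (∀ x → length (f x) ≡ c) →
    ∀ xs → length (concatMap f xs) ≡ length xs * c
  length-concatMap-const eq []       = refl
  length-concatMap-const {f = f} eq (x ∷ xs) = trans (List.length-++ (f x))
    (cong₂ _+_ (eq x) (length-concatMap-const eq xs))

  -- `applyUpTo` recurses by composing with `suc`, so the induction needs an arbitrary g in place of
  -- the identity behind `upTo`.
  length-concatMap-applyUpTo : ∀ {f : A → List C} {g h} → (∀ i → length (f (g i)) ≡ h i) →
    ∀ n → length (concatMap f (applyUpTo g n)) ≡ ℕ.sum (applyUpTo h n)
  length-concatMap-applyUpTo eq zero    = refl
  length-concatMap-applyUpTo {f = f} {g} eq (suc n) = trans (List.length-++ (f (g 0)))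
    (cong₂ _+_ (eq 0) (length-concatMap-applyUpTo {f = f} (eq ∘ suc) n))

  lookup-extensional : {v w : Vec A k} → (∀ i → lookup v i ≡ lookup w i) → v ≡ w
  lookup-extensional {v = v} {w} eq =
    trans (sym (Vec.tabulate∘lookup v)) (trans (Vec.tabulate-cong eq) (Vec.tabulate∘lookup w))

  toList-injective : {v w : Vec A k} → toList v ≡ toList w → v ≡ w
  toList-injective {v = []}    {[]}    eq = refl
  toList-injective {v = x ∷ v} {y ∷ w} eq =
    cong₂ _∷_ (List.∷-injectiveˡ eq) (toList-injective (List.∷-injectiveʳ eq))

  -- Partial partitions and insertion of a least element

  -- The rows with index below j are blocks already begun by smaller elements not in
  -- Fin n: they may be empty, and their order is settled.
  record IsPartialPartition {n k} (j : ℕ) (B : Vec (Subset n) k) : Set where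
    field
      nonempty : ∀ i → j ≤ toℕ i → Nonempty (lookup B i)
      disjoint : ∀ i i′ → i ≢ i′ → Empty (lookup B i ∩ lookup B i′)
      cover    : ∀ x → ∃ λ i → x ∈ lookup B i
      ordered  : ∀ i i′ → j ≤ toℕ i → i Fin.< i′ → min (lookup B i) < min (lookup B i′)

  -- A vector of k subsets of `Fin n` is a Boolean matrix with k rows and n columns. The column put
  -- in front is the singleton `⁅ i ⁆`: the new element lies in row i only.
  addElement : Fin k → Vec (Subset n) k → Vec (Subset (suc n)) k
  addElement i = zipWith _∷_ ⁅ i ⁆

  module _ (i : Fin k) (B : Vec (Subset n) k) where

    lookup-addElement : ∀ r → lookup (addElement i B) r ≡ lookup ⁅ i ⁆ r ∷ lookup B r
    lookup-addElement r = Vec.lookup-zipWith _∷_ r ⁅ i ⁆ B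

    lookup-addElement-≡ : lookup (addElement i B) i ≡ inside ∷ lookup B i
    lookup-addElement-≡ = trans (lookup-addElement i) (cong (_∷ lookup B i) (Vec.[]=⇒lookup (x∈⁅x⁆ i)))

    lookup-addElement-≢ : ∀ {r} → r ≢ i → lookup (addElement i B) r ≡ outside ∷ lookup B r
    lookup-addElement-≢ {r} r≢i = trans (lookup-addElement r)
      (cong (_∷ lookup B r) (Bool.¬-not λ eq → r≢i (x∈⁅y⁆⇒x≡y i (Vec.lookup⇒[]= r ⁅ i ⁆ eq))))

    zero∈addElement : zero ∈ lookup (addElement i B) i
    zero∈addElement = subst (zero ∈_) (sym lookup-addElement-≡) Vec.here

    zero∈addElement⁻ : ∀ r → zero ∈ lookup (addElement i B) r → r ≡ i
    zero∈addElement⁻ r 0∈ with r Fin.≟ i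
    ... | yes r≡i = r≡i
    ... | no  r≢i with () ← subst (zero ∈_) (lookup-addElement-≢ r≢i) 0∈

    suc∈addElement : ∀ r {x} → x ∈ lookup B r → suc x ∈ lookup (addElement i B) r
    suc∈addElement r x∈ = subst (_ ∈_) (sym (lookup-addElement r)) (Vec.there x∈)

    suc∈addElement⁻ : ∀ r {x} → suc x ∈ lookup (addElement i B) r → x ∈ lookup B r
    suc∈addElement⁻ r x∈ with Vec.there p ← subst (_ ∈_) (lookup-addElement r) x∈ = p

    min-addElement-≡ : min (lookup (addElement i B) i) ≡ 0
    min-addElement-≡ = cong min lookup-addElement-≡

    min-addElement-≢ : ∀ {r} → r ≢ i → min (lookup (addElement i B) r) ≡ suc (min (lookup B r))
    min-addElement-≢ r≢i = cong min (lookup-addElement-≢ r≢i)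

    -- Two thresholds cover both kinds of insertion: j′ = j when i < j, where the element joins a
    -- begun block, and j′ = suc j when i = j, where it begins the next one. Row i receives minimum
    -- 0 and every other minimum grows by one, so the order of the other rows is kept.
    addElement⁺ : ∀ {j j′} → toℕ i ≤ j → (∀ r → j ≤ toℕ r → r ≢ i → j′ ≤ toℕ r) →
      IsPartialPartition j′ B → IsPartialPartition j (addElement i B)
    addElement⁺ {j} i≤j bound p = record
      { nonempty = nonempty′ ; disjoint = disjoint′ ; cover = cover′ ; ordered = ordered′ }
      where
      open IsPartialPartition p

      nonempty′ : ∀ r → j ≤ toℕ r → Nonempty (lookup (addElement i B) r)
      nonempty′ r j≤r with r Fin.≟ i
      ... | yes refl = zero , zero∈addElement
      ... | no  r≢i  = let x , x∈ = nonempty r (bound r j≤r r≢i) in suc x , suc∈addElement r x∈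

      disjoint′ : ∀ r r′ → r ≢ r′ → Empty (lookup (addElement i B) r ∩ lookup (addElement i B) r′)
      disjoint′ r r′ r≢r′ (x , x∈) with x∈p∩q⁻ (lookup (addElement i B) r) _ x∈
      disjoint′ r r′ r≢r′ (zero  , _) | ∈r , ∈r′ =
        r≢r′ (trans (zero∈addElement⁻ r ∈r) (sym (zero∈addElement⁻ r′ ∈r′)))
      disjoint′ r r′ r≢r′ (suc x , _) | ∈r , ∈r′ =
        disjoint r r′ r≢r′ (x , x∈p∩q⁺ (suc∈addElement⁻ r ∈r , suc∈addElement⁻ r′ ∈r′))

      cover′ : ∀ x → ∃ λ r → x ∈ lookup (addElement i B) r
      cover′ zero    = i , zero∈addElement
      cover′ (suc x) = let r , x∈ = cover x in r , suc∈addElement r x∈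

      ordered′ : ∀ r r′ → j ≤ toℕ r → r Fin.< r′ →
        min (lookup (addElement i B) r) < min (lookup (addElement i B) r′)
      ordered′ r r′ j≤r r<r′ with r Fin.≟ i
      ... | yes refl = subst₂ _<_ (sym min-addElement-≡) (sym (min-addElement-≢ (Fin.<⇒≢ r<r′ ∘ sym))) z<s
      -- Row r′ is not row i either: otherwise r < i ≤ j ≤ r.
      ... | no  r≢i  = subst₂ _<_ (sym (min-addElement-≢ r≢i))
        (sym (min-addElement-≢ λ { refl → ℕ.<⇒≱ r<r′ (ℕ.≤-trans i≤j j≤r) }))
        (s<s (ordered r r′ (bound r j≤r r≢i) r<r′))

    addElement⁻ : ∀ {j j′} → (∀ r → j′ ≤ toℕ r → j ≤ toℕ r × r ≢ i) →
      IsPartialPartition j (addElement i B) → IsPartialPartition j′ B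
    addElement⁻ {j} {j′} bound p = record
      { nonempty = nonempty′ ; disjoint = disjoint′ ; cover = cover′ ; ordered = ordered′ }
      where
      open IsPartialPartition p

      nonempty′ : ∀ r → j′ ≤ toℕ r → Nonempty (lookup B r)
      nonempty′ r j′≤r with bound r j′≤r
      ... | j≤r , r≢i with nonempty r j≤r
      ... | zero  , 0∈ = contradiction (zero∈addElement⁻ r 0∈) r≢i
      ... | suc x , x∈ = x , suc∈addElement⁻ r x∈

      disjoint′ : ∀ r r′ → r ≢ r′ → Empty (lookup B r ∩ lookup B r′)
      disjoint′ r r′ r≢r′ (x , x∈) = let ∈r , ∈r′ = x∈p∩q⁻ (lookup B r) _ x∈ in
        disjoint r r′ r≢r′ (suc x , x∈p∩q⁺ (suc∈addElement r ∈r , suc∈addElement r′ ∈r′))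

      cover′ : ∀ x → ∃ λ r → x ∈ lookup B r
      cover′ x = let r , x∈ = cover (suc x) in r , suc∈addElement⁻ r x∈

      ordered′ : ∀ r r′ → j′ ≤ toℕ r → r Fin.< r′ → min (lookup B r) < min (lookup B r′)
      ordered′ r r′ j′≤r r<r′ = s<s⁻¹ (subst₂ _<_
        (min-addElement-≢ (proj₂ (bound r j′≤r)))
        (min-addElement-≢ (proj₂ (bound r′ (ℕ.≤-trans j′≤r (ℕ.<⇒≤ r<r′)))))
        (ordered r r′ (proj₁ (bound r j′≤r)) r<r′))

    -- If j < i, row j would need a minimum below that of row i, which is 0. So no block can be
    -- begun before its predecessors.
    addElement-bound : ∀ {j} → IsPartialPartition j (addElement i B) → toℕ i ≤ j
    addElement-bound {j} p = ℕ.≮⇒≥ λ j<i →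
      let r   = fromℕ< (ℕ.<-trans j<i (Fin.toℕ<n i))
          r≡j = Fin.toℕ-fromℕ< (ℕ.<-trans j<i (Fin.toℕ<n i))
      in ℕ.n≮0 (subst (min (lookup (addElement i B) r) <_) min-addElement-≡
           (IsPartialPartition.ordered p r i (ℕ.≤-reflexive (sym r≡j)) (subst (_< toℕ i) (sym r≡j) j<i)))

  addElement-injective : ∀ {i i′ : Fin k} {B B′ : Vec (Subset n) k} →
    addElement i B ≡ addElement i′ B′ → i ≡ i′ × B ≡ B′
  addElement-injective {i = i} {i′} {B} {B′} eq =
    zero∈addElement⁻ i′ B′ i (subst (λ C → zero ∈ lookup C i) eq (zero∈addElement i B)) ,
    lookup-extensional λ r → Vec.∷-injectiveʳ (trans (sym (lookup-addElement i B r))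
      (trans (cong (λ C → lookup C r) eq) (lookup-addElement i′ B′ r)))

  -- `cover` puts `zero` into some row and `disjoint` keeps it out of all others, so the first
  -- column is a singleton.
  addElement-surjective : ∀ {j} {B : Vec (Subset (suc n)) k} → IsPartialPartition j B →
    ∃₂ λ i B′ → B ≡ addElement i B′
  addElement-surjective {B = B} p = i , Vec.map Vec.tail B , lookup-extensional row
    where
    open IsPartialPartition p
    i = proj₁ (cover zero)

    head-≢ : ∀ r → r ≢ i → Vec.head (lookup B r) ≡ outside
    head-≢ r r≢i with lookup B r in eq
    ... | outside ∷ _ = refl
    ... | inside  ∷ _ = contradiction
      (zero , x∈p∩q⁺ (subst (zero ∈_) (sym eq) Vec.here , proj₂ (cover zero)))
      (disjoint r i r≢i)

    head-≡ : Vec.head (lookup B i) ≡ inside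
    head-≡ with lookup B i | proj₂ (cover zero)
    ... | _ | Vec.here = refl

    uncons : (v : Subset (suc n)) → v ≡ Vec.head v ∷ Vec.tail v
    uncons (_ ∷ _) = refl

    row : ∀ r → lookup B r ≡ lookup (addElement i (Vec.map Vec.tail B)) r
    row r with r Fin.≟ i
    ... | yes refl = trans (uncons (lookup B r)) (trans
      (cong₂ _∷_ head-≡ (sym (Vec.lookup-map r Vec.tail B))) (sym (lookup-addElement-≡ i _)))
    ... | no  r≢i  = trans (uncons (lookup B r)) (trans
      (cong₂ _∷_ (head-≢ r r≢i) (sym (Vec.lookup-map r Vec.tail B))) (sym (lookup-addElement-≢ i _ r≢i)))

  -- Enumeration of partial partitions

  choose : ℕ → ℕ → List A → List A → List A
  choose zero    zero    xs ys = ys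
  choose zero    (suc j) xs ys = xs
  choose (suc i) zero    xs ys = []
  choose (suc i) (suc j) xs ys = choose i j xs ys

  module _ {xs ys : List A} where

    choose-< : ∀ {i j} → i < j → choose i j xs ys ≡ xs
    choose-< {zero}  {suc j} _         = refl
    choose-< {suc i} {suc j} (s≤s i<j) = choose-< i<j

    choose-≡ : ∀ i → choose i i xs ys ≡ ys
    choose-≡ zero    = refl
    choose-≡ (suc i) = choose-≡ i

    choose-> : ∀ {i j} → j < i → choose i j xs ys ≡ []
    choose-> {suc i} {zero}  _         = refl
    choose-> {suc i} {suc j} (s≤s j<i) = choose-> j<i

    choose-unique : ∀ i j → Unique xs → Unique ys → Unique (choose i j xs ys)
    choose-unique zero    zero    ux uy = uy
    choose-unique zero    (suc j) ux uy = ux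
    choose-unique (suc i) zero    ux uy = []
    choose-unique (suc i) (suc j) ux uy = choose-unique i j ux uy

  module _ {C : Set} (xs ys : List A) where

    length-choose-≥ : ∀ {k j} {f : Fin k → A → C} → k ≤ j →
      length (concat (tabulate λ i → map (f i) (choose (toℕ i) j xs ys))) ≡ k * length xs
    length-choose-≥ {k = zero}              _         = refl
    length-choose-≥ {k = suc k} {suc j} {f} (s≤s k≤j) = trans (List.length-++ (map (f zero) xs))
      (cong₂ _+_ (List.length-map (f zero) xs) (length-choose-≥ {f = λ i → f (suc i)} k≤j))

    -- Each of the j rows already begun contributes `xs`, row j contributes `ys`, and the rows after
    -- it contribute nothing. The map f may depend on the row, so that the induction can pass to the
    -- later rows.
    length-choose-< : ∀ {k j} {f : Fin k → A → C} → j < k →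
      length (concat (tabulate λ i → map (f i) (choose (toℕ i) j xs ys))) ≡ j * length xs + length ys
    length-choose-< {k = suc k} {zero}  {f} _         = trans (List.length-++ (map (f zero) ys))
      (trans (cong₂ _+_ (List.length-map (f zero) ys) (nothingAbove k (λ i → f (suc i)))) (ℕ.+-identityʳ _))
      where
      nothingAbove : ∀ k (g : Fin k → A → C) →
        length (concat (tabulate λ i → map (g i) (choose (suc (toℕ i)) 0 xs ys))) ≡ 0
      nothingAbove zero    g = refl
      nothingAbove (suc k) g = nothingAbove k (λ i → g (suc i))
    length-choose-< {k = suc k} {suc j} {f} (s≤s j<k) = trans (List.length-++ (map (f zero) xs))
      (trans (cong₂ _+_ (List.length-map (f zero) xs) (length-choose-< {f = λ i → f (suc i)} j<k))
        (sym (ℕ.+-assoc (length xs) _ _)))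

  partialPartitions : ∀ k n → ℕ → List (Vec (Subset n) k)
  -- With no elements left all rows are empty, which is admissible exactly when no row has index at
  -- least j.
  partialPartitions k zero    j with k ℕ.≤? j
  ... | yes _ = replicate k [] ∷ []
  ... | no  _ = []
  partialPartitions k (suc n) j = concatMap
    -- The three cases of `choose` are: joining a begun block, beginning the next block, and
    -- skipping a block. Being structural in both numbers, it reduces when `toℕ (suc i)` meets
    -- `suc j`, which the length lemmas rely on.
    (λ i → map (addElement i) (choose (toℕ i) j (partialPartitions k n j) (partialPartitions k n (suc j))))
    (allFin k)

  ∈-partialPartitions⁺ : ∀ {j} {B : Vec (Subset n) k} → IsPartialPartition j B → B ∈ˡ partialPartitions k n j
  ∈-partialPartitions⁺ {zero} {k} {j} {B} p with k ℕ.≤? j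
  ... | yes _   = here (lookup-extensional λ r → empty (lookup B r) (lookup (replicate k []) r))
    where
    empty : (v w : Subset 0) → v ≡ w
    empty [] [] = refl
  -- Row j exists and would have to contain an element of `Fin 0`.
  ... | no  k≰j with () ← proj₁ (IsPartialPartition.nonempty p (fromℕ< (ℕ.≰⇒> k≰j))
                            (ℕ.≤-reflexive (sym (Fin.toℕ-fromℕ< (ℕ.≰⇒> k≰j)))))
  ∈-partialPartitions⁺ {suc n} {k} {j} p with addElement-surjective p
  ... | i , B′ , refl = ∈-concatMap (∈-allFin i) (∈-map⁺ (addElement i) B′∈)
    where
    B′∈ : B′ ∈ˡ choose (toℕ i) j (partialPartitions k n j) (partialPartitions k n (suc j))
    B′∈ with ℕ.<-cmp (toℕ i) j
    ... | tri< i<j _ _ = subst (B′ ∈ˡ_) (sym (choose-< i<j)) (∈-partialPartitions⁺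
      (addElement⁻ i B′ (λ r j≤r → j≤r , λ { refl → ℕ.<⇒≱ i<j j≤r }) p))
    -- Removing the element that began row i may leave that row empty, so the threshold moves past
    -- it.
    ... | tri≈ _ refl _ = subst (B′ ∈ˡ_) (sym (choose-≡ (toℕ i))) (∈-partialPartitions⁺
      (addElement⁻ i B′ (λ r i<r → ℕ.<⇒≤ i<r , λ { refl → ℕ.<-irrefl refl i<r }) p))
    ... | tri> _ _ j<i = contradiction (addElement-bound i B′ p) (ℕ.<⇒≱ j<i)

  ∈-partialPartitions⁻ : ∀ {j} {B : Vec (Subset n) k} → B ∈ˡ partialPartitions k n j → IsPartialPartition j B
  ∈-partialPartitions⁻ {zero} {k} {j} B∈ with k ℕ.≤? j | B∈
  ... | yes k≤j | here refl = record
    { nonempty = λ i j≤i → contradiction (ℕ.≤-trans k≤j j≤i) (ℕ.<⇒≱ (Fin.toℕ<n i))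
    ; disjoint = λ _ _ _ ()
    ; cover    = λ ()
    ; ordered  = λ i _ j≤i _ → contradiction (ℕ.≤-trans k≤j j≤i) (ℕ.<⇒≱ (Fin.toℕ<n i))
    }
  ∈-partialPartitions⁻ {suc n} {k} {j} B∈ with ∈-concatMap⇒∃ (allFin k) B∈
  ... | i , _ , B∈i with ∈-map⁻ (addElement i) B∈i
  ... | B′ , B′∈ , refl with ℕ.<-cmp (toℕ i) j
  ... | tri< i<j _ _ = addElement⁺ i B′ (ℕ.<⇒≤ i<j) (λ _ j≤r _ → j≤r)
    (∈-partialPartitions⁻ (subst (B′ ∈ˡ_) (choose-< i<j) B′∈))
  ... | tri≈ _ refl _ = addElement⁺ i B′ ℕ.≤-refl
    (λ r i≤r r≢i → ℕ.≤∧≢⇒< i≤r (r≢i ∘ sym ∘ Fin.toℕ-injective))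
    (∈-partialPartitions⁻ (subst (B′ ∈ˡ_) (choose-≡ (toℕ i)) B′∈))
  ... | tri> _ _ j<i with () ← subst (B′ ∈ˡ_) (choose-> j<i) B′∈

  partialPartitions-unique : ∀ k n j → Unique (partialPartitions k n j)
  partialPartitions-unique k zero    j with k ℕ.≤? j
  ... | yes _ = [] ∷ []
  ... | no  _ = []
  partialPartitions-unique k (suc n) j = concatMap-unique (Unique.allFin⁺ k)
    (λ {i} _ → Unique.map⁺ (proj₂ ∘ addElement-injective {i = i} {i})
      (choose-unique (toℕ i) j (partialPartitions-unique k n j) (partialPartitions-unique k n (suc j))))
    (λ {i} {i′} _ _ B∈i B∈i′ →
      let _ , _ , eq  = ∈-map⁻ (addElement i) B∈i
          _ , _ , eq′ = ∈-map⁻ (addElement i′) B∈i′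
      in proj₁ (addElement-injective (trans (sym eq) eq′)))

  -- Counts the ways to distribute n further elements when j blocks are begun and exactly m more
  -- have to be begun. These are the r-Stirling numbers with r = j, for n + j elements in m + j
  -- blocks, of which j elements are in distinct blocks.
  completions : ℕ → ℕ → ℕ → ℕ
  completions j zero    zero    = 1
  completions j (suc m) zero    = 0
  completions j zero    (suc n) = j * completions j zero n
  completions j (suc m) (suc n) = j * completions j (suc m) n + completions (suc j) m n

  -- The number k of rows is part of the type of the vectors and stays fixed while j grows and m
  -- shrinks, so their relation is carried as an equation.
  length-partialPartitions : ∀ n j m {k} → j + m ≡ k → length (partialPartitions k n j) ≡ completions j m n
  length-partialPartitions zero j zero {k} eq with k ℕ.≤? j
  ... | yes _   = refl
  ... | no  k≰j = contradiction (ℕ.≤-reflexive (trans (sym eq) (ℕ.+-identityʳ j))) k≰j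
  length-partialPartitions zero j (suc m) {k} eq with k ℕ.≤? j
  ... | yes k≤j = contradiction (subst (_≤ j) (sym eq) k≤j) (ℕ.m+1+n≰m j)
  ... | no  _   = refl
  length-partialPartitions (suc n) j zero {k} eq = trans
    (cong (length ∘ concat) (List.map-tabulate {n = k} id _))
    (trans (length-choose-≥ (partialPartitions k n j) (partialPartitions k n (suc j)) {f = addElement}
        (ℕ.≤-reflexive k≡j))
      (cong₂ _*_ k≡j (length-partialPartitions n j zero eq)))
    where
    k≡j : k ≡ j
    k≡j = trans (sym eq) (ℕ.+-identityʳ j)
  length-partialPartitions (suc n) j (suc m) {k} eq = trans
    (cong (length ∘ concat) (List.map-tabulate {n = k} id _))
    (trans (length-choose-< (partialPartitions k n j) (partialPartitions k n (suc j)) {f = addElement}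
        (subst (j <_) eq (ℕ.m<m+n j z<s)))
      (cong₂ _+_ (cong (j *_) (length-partialPartitions n j (suc m) eq))
                 (length-partialPartitions n (suc j) m (trans (sym (ℕ.+-suc j m)) eq))))

  -- The definition removes the least element; this recurrence removes the greatest, which joins any
  -- of the j + suc m blocks or forms the last of them alone. Both recursions are linear, so
  -- expanding by one and then by the other gives the same terms; since the definition raises j, the
  -- induction needs every j, and j = 0 yields the Stirling recurrence.
  completions-suc : ∀ n j m → completions j (suc m) (suc n) ≡ (j + suc m) * completions j (suc m) n + completions j m n
  completions-suc zero j zero    = cong (_+ 1) (trans (ℕ.*-zeroʳ j) (sym (ℕ.*-zeroʳ (j + 1))))
  completions-suc zero j (suc m) = cong (_+ 0) (trans (ℕ.*-zeroʳ j) (sym (ℕ.*-zeroʳ (j + suc (suc m)))))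
  -- With no block to begin besides the one in question, the terms with m = 0 unfold by definition
  -- and one induction hypothesis suffices.
  completions-suc (suc n) j zero = trans
    (cong (λ x → j * x + suc j * completions (suc j) 0 n) (completions-suc n j 0))
    (lemma j (completions j 1 n) (completions j 0 n) (completions (suc j) 0 n))
    where
    lemma : ∀ j a b c → j * ((j + 1) * a + b) + suc j * c ≡ (j + 1) * (j * a + c) + j * b
    lemma = solve-∀
  completions-suc (suc n) j (suc m) = trans
    (cong₂ (λ x y → j * x + y) (completions-suc n j (suc m)) (completions-suc n (suc j) m))
    (lemma j m (completions j (suc (suc m)) n) (completions j (suc m) n)
      (completions (suc j) (suc m) n) (completions (suc j) m n))
    where
    lemma : ∀ j m a b c d → j * ((j + suc (suc m)) * a + b) + ((suc j + suc m) * c + d)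
          ≡ (j + suc (suc m)) * (j * a + c) + (j * b + d)
    lemma = solve-∀

  completions≡stirling₂ : ∀ n k → completions 0 k n ≡ stirling₂ n k
  completions≡stirling₂ zero    zero    = refl
  completions≡stirling₂ zero    (suc k) = refl
  completions≡stirling₂ (suc n) zero    = refl
  completions≡stirling₂ (suc n) (suc k) = trans (completions-suc n 0 k)
    (cong₂ (λ x y → suc k * x + y) (completions≡stirling₂ n (suc k)) (completions≡stirling₂ n k))

  -- Fibonacci permutations

  fixFirst : Vec (Fin k) k → Vec (Fin (suc k)) (suc k)
  fixFirst σ = zero ∷ Vec.map suc σ

  swapFirst : Vec (Fin k) k → Vec (Fin (suc (suc k))) (suc (suc k))
  swapFirst σ = suc zero ∷ zero ∷ Vec.map suc (Vec.map suc σ)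

  module _ {σ : Vec (Fin k) k} where

    private
      suc² : ∀ {m} → Fin m → Fin (suc (suc m))
      suc² i = suc (suc i)

    lookup-suc : ∀ i → lookup (fixFirst σ) (suc i) ≡ suc (lookup σ i)
    lookup-suc i = Vec.lookup-map i suc σ

    lookup-suc-suc : ∀ i → lookup (swapFirst σ) (suc (suc i)) ≡ suc (suc (lookup σ i))
    lookup-suc-suc i = trans (Vec.lookup-map i suc (Vec.map suc σ)) (cong suc (Vec.lookup-map i suc σ))

    fixFirst⁺ : IsFibonacciPermutation σ → IsFibonacciPermutation (fixFirst σ)
    fixFirst⁺ (mkIsFibonacciPermutation (inj , surj) near) =
      mkIsFibonacciPermutation ((λ {i} {j} → inj′ i j) , strictlySurjective⇒surjective surj′) near′
      where
      inj′ : ∀ i j → lookup (fixFirst σ) i ≡ lookup (fixFirst σ) j → i ≡ j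
      inj′ zero    zero    _  = refl
      inj′ zero    (suc j) eq with () ← trans eq (lookup-suc j)
      inj′ (suc i) zero    eq with () ← trans (sym eq) (lookup-suc i)
      inj′ (suc i) (suc j) eq =
        cong suc (inj (Fin.suc-injective (trans (sym (lookup-suc i)) (trans eq (lookup-suc j)))))
      surj′ : ∀ y → ∃ λ i → lookup (fixFirst σ) i ≡ y
      surj′ zero    = zero , refl
      surj′ (suc y) = let i , eq = surjective⇒strictlySurjective surj y in
        suc i , trans (lookup-suc i) (cong suc eq)
      near′ : ∀ i → ∣ toℕ (lookup (fixFirst σ) i) - toℕ i ∣ ≤ 1
      near′ zero    = z≤n
      near′ (suc i) rewrite lookup-suc i = near i

    fixFirst⁻ : IsFibonacciPermutation (fixFirst σ) → IsFibonacciPermutation σ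
    fixFirst⁻ (mkIsFibonacciPermutation (inj , surj) near) =
      mkIsFibonacciPermutation (inj′ , strictlySurjective⇒surjective surj′) near′
      where
      inj′ : ∀ {i j} → lookup σ i ≡ lookup σ j → i ≡ j
      inj′ {i} {j} eq =
        Fin.suc-injective (inj (trans (lookup-suc i) (trans (cong suc eq) (sym (lookup-suc j)))))
      surj′ : ∀ y → ∃ λ i → lookup σ i ≡ y
      surj′ y with surjective⇒strictlySurjective surj (suc y)
      ... | suc i , eq = i , Fin.suc-injective (trans (sym (lookup-suc i)) eq)
      near′ : ∀ i → ∣ toℕ (lookup σ i) - toℕ i ∣ ≤ 1
      near′ i = subst (λ x → ∣ toℕ x - suc (toℕ i) ∣ ≤ 1) (lookup-suc i) (near (suc i))

    swapFirst⁺ : IsFibonacciPermutation σ → IsFibonacciPermutation (swapFirst σ)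
    swapFirst⁺ (mkIsFibonacciPermutation (inj , surj) near) =
      mkIsFibonacciPermutation ((λ {i} {j} → inj′ i j) , strictlySurjective⇒surjective surj′) near′
      where
      inj′ : ∀ i j → lookup (swapFirst σ) i ≡ lookup (swapFirst σ) j → i ≡ j
      inj′ zero          zero          _  = refl
      inj′ (suc zero)    (suc zero)    _  = refl
      inj′ zero          (suc (suc j)) eq with () ← trans eq (lookup-suc-suc j)
      inj′ (suc zero)    (suc (suc j)) eq with () ← trans eq (lookup-suc-suc j)
      inj′ (suc (suc i)) zero          eq with () ← trans (sym eq) (lookup-suc-suc i)
      inj′ (suc (suc i)) (suc zero)    eq with () ← trans (sym eq) (lookup-suc-suc i)
      inj′ (suc (suc i)) (suc (suc j)) eq = cong suc² (inj (Fin.suc-injective (Fin.suc-injective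
        (trans (sym (lookup-suc-suc i)) (trans eq (lookup-suc-suc j))))))
      surj′ : ∀ y → ∃ λ i → lookup (swapFirst σ) i ≡ y
      surj′ zero          = suc zero , refl
      surj′ (suc zero)    = zero , refl
      surj′ (suc (suc y)) = let i , eq = surjective⇒strictlySurjective surj y in
        suc (suc i) , trans (lookup-suc-suc i) (cong suc² eq)
      near′ : ∀ i → ∣ toℕ (lookup (swapFirst σ) i) - toℕ i ∣ ≤ 1
      near′ zero          = ℕ.≤-refl
      near′ (suc zero)    = ℕ.≤-refl
      near′ (suc (suc i)) rewrite lookup-suc-suc i = near i

    swapFirst⁻ : IsFibonacciPermutation (swapFirst σ) → IsFibonacciPermutation σ
    swapFirst⁻ (mkIsFibonacciPermutation (inj , surj) near) =
      mkIsFibonacciPermutation (inj′ , strictlySurjective⇒surjective surj′) near′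
      where
      inj′ : ∀ {i j} → lookup σ i ≡ lookup σ j → i ≡ j
      inj′ {i} {j} eq = Fin.suc-injective (Fin.suc-injective
        (inj (trans (lookup-suc-suc i) (trans (cong suc² eq) (sym (lookup-suc-suc j))))))
      surj′ : ∀ y → ∃ λ i → lookup σ i ≡ y
      surj′ y with surjective⇒strictlySurjective surj (suc (suc y))
      ... | suc (suc i) , eq = i , Fin.suc-injective (Fin.suc-injective (trans (sym (lookup-suc-suc i)) eq))
      near′ : ∀ i → ∣ toℕ (lookup σ i) - toℕ i ∣ ≤ 1
      near′ i = subst (λ x → ∣ toℕ x - suc (suc (toℕ i)) ∣ ≤ 1) (lookup-suc-suc i) (near (suc (suc i)))

  -- Once the value 0 is taken, injectivity keeps it out of the remaining entries, which can then be
  -- lowered by one. The length l is free because this is applied to a part of a permutation, twice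
  -- in succession after a swap.
  avoids-zero : ∀ {l} (v : Vec (Fin (suc k)) l) → (∀ i → lookup v i ≢ zero) → ∃ λ w → v ≡ Vec.map suc w
  avoids-zero []          _  = [] , refl
  avoids-zero (zero  ∷ v) ≢0 = contradiction refl (≢0 zero)
  avoids-zero (suc x ∷ v) ≢0 = let w , eq = avoids-zero v (≢0 ∘ suc) in x ∷ w , cong (suc x ∷_) eq

  -- Only the first two positions can hold the value 0, and if the second one
  -- does then the first one can only hold the value 1.
  fix-or-swap : {σ : Vec (Fin (suc (suc k))) (suc (suc k))} → IsFibonacciPermutation σ →
    (∃ λ τ → σ ≡ fixFirst τ) ⊎ (∃ λ τ → σ ≡ swapFirst τ)
  fix-or-swap {σ = x ∷ y ∷ v} (mkIsFibonacciPermutation (inj , surj) near)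
    with surjective⇒strictlySurjective surj zero
  ... | zero , refl =
    let τ , eq = avoids-zero (y ∷ v) (λ i eq → Fin.0≢1+n (sym (inj {suc i} {zero} eq))) in
    inj₁ (τ , cong (zero ∷_) eq)
  ... | suc (suc i) , eq = contradiction
    (subst (λ z → ∣ toℕ z - suc (suc (toℕ i)) ∣ ≤ 1) eq (near (suc (suc i)))) λ { (s≤s ()) }
  ... | suc zero , refl with x | near zero
  ...   | zero        | _        with () ← inj {zero} {suc zero} refl
  ...   | suc (suc _) | s≤s ()
  ...   | suc zero    | _ =
    let w , eqw = avoids-zero v λ i eq → Fin.0≢1+n (sym (Fin.suc-injective (inj {suc (suc i)} {suc zero} eq)))
        τ , eqτ = avoids-zero w λ i eq → Fin.0≢1+n (sym (inj {suc (suc i)} {zero}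
          (trans (cong (λ u → lookup u i) eqw) (trans (Vec.lookup-map i suc w) (cong suc eq)))))
    in inj₂ (τ , cong (λ u → suc zero ∷ zero ∷ u) (trans eqw (cong (λ u → Vec.map (λ i → suc i) u) eqτ)))

  map-suc-injective : ∀ {l} {v w : Vec (Fin k) l} → Vec.map Fin.suc v ≡ Vec.map suc w → v ≡ w
  map-suc-injective {v = []}    {[]}    _  = refl
  map-suc-injective {v = _ ∷ _} {_ ∷ _} eq =
    cong₂ _∷_ (Fin.suc-injective (Vec.∷-injectiveˡ eq)) (map-suc-injective (Vec.∷-injectiveʳ eq))

  fixFirst-injective : {σ τ : Vec (Fin k) k} → fixFirst σ ≡ fixFirst τ → σ ≡ τ
  fixFirst-injective eq = map-suc-injective (Vec.∷-injectiveʳ eq)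

  swapFirst-injective : {σ τ : Vec (Fin k) k} → swapFirst σ ≡ swapFirst τ → σ ≡ τ
  swapFirst-injective eq = map-suc-injective (map-suc-injective (Vec.∷-injectiveʳ (Vec.∷-injectiveʳ eq)))

  fibonacciPerms : ∀ k → List (Vec (Fin k) k)
  fibonacciPerms zero          = [] ∷ []
  fibonacciPerms (suc zero)    = (zero ∷ []) ∷ []
  fibonacciPerms (suc (suc k)) = map fixFirst (fibonacciPerms (suc k)) ++ map swapFirst (fibonacciPerms k)

  ∈-fixOrSwap⁺ : ∀ {xs ys} →
    (∀ {τ : Vec (Fin (suc k)) (suc k)} → IsFibonacciPermutation τ → τ ∈ˡ xs) →
    (∀ {τ : Vec (Fin k) k} → IsFibonacciPermutation τ → τ ∈ˡ ys) →
    ∀ {σ} → IsFibonacciPermutation σ → σ ∈ˡ map fixFirst xs ++ map swapFirst ys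
  ∈-fixOrSwap⁺ {xs = xs} all-xs all-ys p with fix-or-swap p
  ... | inj₁ (τ , refl) = ∈-++⁺ˡ (∈-map⁺ fixFirst (all-xs (fixFirst⁻ p)))
  ... | inj₂ (τ , refl) = ∈-++⁺ʳ (map fixFirst xs) (∈-map⁺ swapFirst (all-ys (swapFirst⁻ p)))

  ∈-fixOrSwap⁻ : ∀ {xs ys} →
    (∀ {τ : Vec (Fin (suc k)) (suc k)} → τ ∈ˡ xs → IsFibonacciPermutation τ) →
    (∀ {τ : Vec (Fin k) k} → τ ∈ˡ ys → IsFibonacciPermutation τ) →
    ∀ {σ} → σ ∈ˡ map fixFirst xs ++ map swapFirst ys → IsFibonacciPermutation σ
  ∈-fixOrSwap⁻ {xs = xs} fib-xs fib-ys σ∈ with ∈-++⁻ (map fixFirst xs) σ∈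
  ... | inj₁ p with τ , τ∈ , refl ← ∈-map⁻ fixFirst p = fixFirst⁺ (fib-xs τ∈)
  ... | inj₂ p with τ , τ∈ , refl ← ∈-map⁻ swapFirst p = swapFirst⁺ (fib-ys τ∈)

  ∈-fibonacciPerms⁺ : ∀ k {σ : Vec (Fin k) k} → IsFibonacciPermutation σ → σ ∈ˡ fibonacciPerms k
  ∈-fibonacciPerms⁺ zero          {[]}        _ = here refl
  ∈-fibonacciPerms⁺ (suc zero)    {zero ∷ []} _ = here refl
  ∈-fibonacciPerms⁺ (suc (suc k)) = ∈-fixOrSwap⁺ (∈-fibonacciPerms⁺ (suc k)) (∈-fibonacciPerms⁺ k)

  ∈-fibonacciPerms⁻ : ∀ k {σ : Vec (Fin k) k} → σ ∈ˡ fibonacciPerms k → IsFibonacciPermutation σ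
  ∈-fibonacciPerms⁻ zero          (here refl) = mkIsFibonacciPermutation ((λ { {()} }) , λ ()) λ ()
  ∈-fibonacciPerms⁻ (suc zero)    (here refl) = fixFirst⁺ (∈-fibonacciPerms⁻ zero (here refl))
  ∈-fibonacciPerms⁻ (suc (suc k))             = ∈-fixOrSwap⁻ (∈-fibonacciPerms⁻ (suc k)) (∈-fibonacciPerms⁻ k)

  fibonacciPerms-unique : ∀ k → Unique (fibonacciPerms k)
  fibonacciPerms-unique zero          = [] ∷ []
  fibonacciPerms-unique (suc zero)    = [] ∷ []
  fibonacciPerms-unique (suc (suc k)) = Unique.++⁺
    (Unique.map⁺ fixFirst-injective (fibonacciPerms-unique (suc k)))
    (Unique.map⁺ swapFirst-injective (fibonacciPerms-unique k))
    λ (p , q) → fix≢swap (∈-map⁻ fixFirst p) (∈-map⁻ swapFirst q)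
    where
    fix≢swap : ∀ {σ} → (∃ λ τ → τ ∈ˡ fibonacciPerms (suc k) × σ ≡ fixFirst τ) →
      (∃ λ τ → τ ∈ˡ fibonacciPerms k × σ ≡ swapFirst τ) → _
    fix≢swap (_ , _ , refl) (_ , _ , ())

  length-fibonacciPerms : ∀ k → length (fibonacciPerms k) ≡ fib k
  length-fibonacciPerms zero          = refl
  length-fibonacciPerms (suc zero)    = refl
  length-fibonacciPerms (suc (suc k)) = trans (List.length-++ (map fixFirst (fibonacciPerms (suc k))))
    (cong₂ _+_
      (trans (List.length-map fixFirst (fibonacciPerms (suc k))) (length-fibonacciPerms (suc k)))
      (trans (List.length-map swapFirst (fibonacciPerms k)) (length-fibonacciPerms k)))

  -- Recovering blocks and permutation from an arrangement

  mono⇒extensive : ∀ {l} (f : Fin k → Fin l) → (∀ {i j} → i Fin.< j → f i Fin.< f j) → ∀ i → toℕ i ≤ toℕ (f i)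
  mono⇒extensive f mono zero    = z≤n
  mono⇒extensive f mono (suc i) = ℕ.≤-<-trans
    -- The value at the predecessor is already large enough and the next one is strictly larger.
    -- Restricting along `inject₁` shrinks the domain only, hence a codomain size l independent of
    -- k.
    (mono⇒extensive (f ∘ inject₁)
      (λ {i} {j} i<j → mono (subst₂ _<_ (sym (Fin.toℕ-inject₁ i)) (sym (Fin.toℕ-inject₁ j)) i<j)) i)
    (mono {inject₁ i} {suc i} (subst (_< suc (toℕ i)) (sym (Fin.toℕ-inject₁ i)) ℕ.≤-refl))

  -- σ′ ∘ σ⁻¹ carries the increasing sequence of minima of B to that of B′, so it
  -- is increasing.
  arrange-≤ : {B B′ : Vec (Subset n) k} {σ σ′ : Vec (Fin k) k} →
    IsSetPartition B → IsSetPartition B′ → IsFibonacciPermutation σ →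
    (∀ i → lookup B (lookup σ i) ≡ lookup B′ (lookup σ′ i)) →
    ∀ i → lookup σ i Fin.≤ lookup σ′ i
  arrange-≤ {k = k} {B} {B′} {σ} {σ′} pB pB′ (mkIsFibonacciPermutation (inj , surj) _) same i =
    subst (λ j → lookup σ i Fin.≤ lookup σ′ j) (inj (σσ⁻¹ (lookup σ i))) (mono⇒extensive τ τ-mono (lookup σ i))
    where
    σ⁻¹ : Fin k → Fin k
    σ⁻¹ x = proj₁ (surjective⇒strictlySurjective surj x)
    σσ⁻¹ : ∀ x → lookup σ (σ⁻¹ x) ≡ x
    σσ⁻¹ x = proj₂ (surjective⇒strictlySurjective surj x)
    τ : Fin k → Fin k
    τ x = lookup σ′ (σ⁻¹ x)
    min-τ : ∀ x → min (lookup B x) ≡ min (lookup B′ (τ x))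
    min-τ x = cong min (trans (cong (lookup B) (sym (σσ⁻¹ x))) (same (σ⁻¹ x)))
    τ-mono : ∀ {x y} → x Fin.< y → τ x Fin.< τ y
    τ-mono {x} {y} x<y with subst₂ _<_ (min-τ x) (min-τ y) (IsSetPartition.ordered pB x y x<y) | Fin.<-cmp (τ x) (τ y)
    ... | _  | tri< lt _ _ = lt
    ... | lt | tri≈ _ eq _ = contradiction lt (ℕ.<-irrefl (cong (min ∘ lookup B′) eq))
    ... | lt | tri> _ _ gt = contradiction lt (ℕ.<-asym (IsSetPartition.ordered pB′ (τ y) (τ x) gt))

  -- `arrange-≤` in both directions forces σ and σ′ to agree. Surjectivity of σ then places every
  -- block of B at some position, where it is compared with the block of B′.
  arrange-injective : {B B′ : Vec (Subset n) k} {σ σ′ : Vec (Fin k) k} →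
    IsSetPartition B → IsSetPartition B′ → IsFibonacciPermutation σ → IsFibonacciPermutation σ′ →
    arrange B σ ≡ arrange B′ σ′ → B ≡ B′ × σ ≡ σ′
  arrange-injective {B = B} {B′} {σ} {σ′} pB pB′ pσ pσ′ eq = lookup-extensional B≡B′ , lookup-extensional σ≡σ′
    where
    same : ∀ i → lookup B (lookup σ i) ≡ lookup B′ (lookup σ′ i)
    same i = trans (sym (Vec.lookup-map i (lookup B) σ))
      (trans (cong (λ v → lookup v i) (toList-injective eq)) (Vec.lookup-map i (lookup B′) σ′))
    σ≡σ′ : ∀ i → lookup σ i ≡ lookup σ′ i
    σ≡σ′ i = Fin.≤-antisym (arrange-≤ {B = B} {B′} {σ} {σ′} pB pB′ pσ same i)
      (arrange-≤ {B = B′} {B} {σ′} {σ} pB′ pB pσ′ (sym ∘ same) i)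
    B≡B′ : ∀ x → lookup B x ≡ lookup B′ x
    B≡B′ x with surjective⇒strictlySurjective (proj₂ (IsFibonacciPermutation.bijective pσ)) x
    ... | i , refl = trans (same i) (cong (lookup B′) (sym (σ≡σ′ i)))

  -- Counting Fibonacci ordered partitions

  length-arrange : (B : Vec (Subset n) k) (σ : Vec (Fin k) k) → length (arrange B σ) ≡ k
  length-arrange B σ = Vec.length-toList (Vec.map (lookup B) σ)

  ∈-setPartitions⁺ : {B : Vec (Subset n) k} → IsSetPartition B → B ∈ˡ partialPartitions k n 0
  ∈-setPartitions⁺ p = ∈-partialPartitions⁺ (record
    { nonempty = λ i _ → nonempty i ; disjoint = disjoint ; cover = cover ; ordered = λ i j _ → ordered i j })
    where open IsSetPartition p

  ∈-setPartitions⁻ : {B : Vec (Subset n) k} → B ∈ˡ partialPartitions k n 0 → IsSetPartition B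
  ∈-setPartitions⁻ B∈ = mkIsSetPartition (λ i → nonempty i z≤n) disjoint cover (λ i j → ordered i j z≤n)
    where open IsPartialPartition (∈-partialPartitions⁻ B∈)

  arrangements : ∀ n k → List (List (Subset n))
  arrangements n k = concatMap (λ B → map (arrange B) (fibonacciPerms k)) (partialPartitions k n 0)

  ∈-arrangements⁺ : {B : Vec (Subset n) k} {σ : Vec (Fin k) k} →
    IsSetPartition B → IsFibonacciPermutation σ → arrange B σ ∈ˡ arrangements n k
  ∈-arrangements⁺ {B = B} pB pσ = ∈-concatMap (∈-setPartitions⁺ pB) (∈-map⁺ (arrange B) (∈-fibonacciPerms⁺ _ pσ))

  ∈-arrangements⁻ : ∀ {A} → A ∈ˡ arrangements n k → ∃₂ λ B σ →
    IsSetPartition B × IsFibonacciPermutation {k} σ × A ≡ arrange B σ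
  ∈-arrangements⁻ {n} {k} A∈ =
    let B , B∈ , A∈B = ∈-concatMap⇒∃ (partialPartitions k n 0) A∈
        σ , σ∈ , eq  = ∈-map⁻ (arrange B) A∈B
    in B , σ , ∈-setPartitions⁻ B∈ , ∈-fibonacciPerms⁻ k σ∈ , eq

  arrangements-unique : ∀ n k → Unique (arrangements n k)
  arrangements-unique n k = concatMap-unique (partialPartitions-unique k n 0)
    -- Injectivity on members is what is available here: `arrange-injective` asks for Fibonacci
    -- permutations.
    (λ B∈ → map-unique (fibonacciPerms-unique k) λ σ∈ σ′∈ eq →
      proj₂ (arrange-injective (∈-setPartitions⁻ B∈) (∈-setPartitions⁻ B∈)
        (∈-fibonacciPerms⁻ k σ∈) (∈-fibonacciPerms⁻ k σ′∈) eq))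
    λ {B} {B′} B∈ B′∈ A∈ A∈′ →
      let σ  , σ∈  , eq  = ∈-map⁻ (arrange B) A∈
          σ′ , σ′∈ , eq′ = ∈-map⁻ (arrange B′) A∈′
      in proj₁ (arrange-injective (∈-setPartitions⁻ B∈) (∈-setPartitions⁻ B′∈)
        (∈-fibonacciPerms⁻ k σ∈) (∈-fibonacciPerms⁻ k σ′∈) (trans (sym eq) eq′))

  length-arrangements : ∀ n k → length (arrangements n k) ≡ stirling₂ n k * fib k
  length-arrangements n k = trans
    (length-concatMap-const {f = λ B → map (arrange B) (fibonacciPerms k)}
      (λ B → trans (List.length-map (arrange B) (fibonacciPerms k)) (length-fibonacciPerms k))
      (partialPartitions k n 0))
    (cong (_* fib k) (trans (length-partialPartitions n 0 k refl) (completions≡stirling₂ n k)))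

  allArrangements : ∀ n → List (List (Subset n))
  allArrangements n = concatMap (arrangements n) (upTo (suc n))

  allArrangements-unique : ∀ n → Unique (allArrangements n)
  allArrangements-unique n = concatMap-unique (Unique.upTo⁺ (suc n))
    (λ {k} _ → arrangements-unique n k)
    -- Arrangements with different numbers of blocks differ in length.
    λ {k} {k′} _ _ A∈ A∈′ → trans (sym (#blocks k A∈)) (#blocks k′ A∈′)
    where
    #blocks : ∀ k {A} → A ∈ˡ arrangements n k → length A ≡ k
    #blocks k A∈ with B , σ , _ , _ , refl ← ∈-arrangements⁻ A∈ = length-arrange B σ

  ∈-allArrangements : {A : List (Subset n)} → A ∈ˡ allArrangements n ⇔ IsFibonacciOrderedPartition A
  ∈-allArrangements {n} {A} = mk⇔ to from
    where
    to : A ∈ˡ allArrangements n → IsFibonacciOrderedPartition A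
    to A∈ = let k , _ , A∈k = ∈-concatMap⇒∃ (upTo (suc n)) A∈ in k , ∈-arrangements⁻ A∈k
    from : IsFibonacciOrderedPartition A → A ∈ˡ allArrangements n
    from (k , B , σ , pB , pσ , refl) = ∈-concatMap (∈-upTo⁺ (s≤s (#blocks≤n pB))) (∈-arrangements⁺ pB pσ)

  -- Two duplicate-free lists with the same members are permutations of each other. Membership in
  -- either list means being a Fibonacci ordered partition, so the deduplicated search is as long as
  -- the structured enumeration.
  fibonacciFubini≡Σ : ∀ n → fibonacciFubini n ≡ ℕ.sum (applyUpTo (λ k → stirling₂ n k * fib k) (suc n))
  fibonacciFubini≡Σ n = trans
    (↭-length (∼bag⇒↭ (unique∧set⇒bag (Unique.deduplicate-! _≟_ (fibonacciOrderedPartitions n))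
      (allArrangements-unique n) (mk⇔ to from))))
    (length-concatMap-applyUpTo {f = arrangements n} (length-arrangements n) (suc n))
    where
    _≟_ = List.≡-dec (Vec.≡-dec Bool._≟_)
    to : ∀ {A} → A ∈ˡ deduplicate _≟_ (fibonacciOrderedPartitions n) → A ∈ˡ allArrangements n
    to A∈ = Equivalence.from ∈-allArrangements (Equivalence.to (∈-fibonacciOrderedPartitions _)
      (∈-deduplicate⁻ _≟_ (fibonacciOrderedPartitions n) A∈))
    from : ∀ {A} → A ∈ˡ allArrangements n → A ∈ˡ deduplicate _≟_ (fibonacciOrderedPartitions n)
    from A∈ = ∈-deduplicate⁺ _≟_ (Equivalence.from (∈-fibonacciOrderedPartitions _)
      (Equivalence.to ∈-allArrangements A∈))

-- Formal power series

module PowerSeriesProperties {c ℓ} (R : CommutativeRing c ℓ) where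
  open CommutativeRing R
  open Algebra.Properties.Semiring.Sum semiring using (*-distribˡ-sum)
  open Algebra.Properties.Monoid.Sum +-monoid using (sum; sum-cong-≋; sum-replicate-zero)
  open Algebra.Properties.CommutativeMonoid.Sum +-commutativeMonoid using (∑-distrib-+)
  open Algebra.Properties.Semiring.Mult semiring
  open Algebra.Properties.CommutativeMonoid.Mult +-commutativeMonoid using (×-distrib-+)
  open Algebra.Properties.Semiring.Exp semiring using (_^_)
  open Algebra.Properties.Ring ring using (-0#≈0#; -‿distribˡ-*)
  open PowerSeries rawRing using (Series; _•_; _⟨_⟩)
  private module S = PowerSeries rawRing
  open Relation.Binary.Reasoning.Setoid setoid
  module Solver = Algebra.Solver.Ring.NaturalCoefficients.Default commutativeSemiring

  derivative : Series → Series
  derivative f n = suc n × f (suc n)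

  ×-zeroʳ : ∀ m → m × 0# ≈ 0#
  ×-zeroʳ m = begin
    m × 0#          ≈⟨ ×-congʳ m (zeroˡ 0#) ⟨
    m × (0# * 0#)   ≈⟨ ×-comm-* m 0# 0# ⟨
    0# * (m × 0#)   ≈⟨ zeroˡ _ ⟩
    0#              ∎

  ×-distrib-sum : ∀ m {l} (t : Fin l → Carrier) → m × sum t ≈ sum (λ i → m × t i)
  ×-distrib-sum m {zero}  t = ×-zeroʳ m
  ×-distrib-sum m {suc l} t = trans (×-distrib-+ _ _ m) (+-congˡ (×-distrib-sum m {l} λ i → t (Fin.suc i)))

  *ˢ-cong : ∀ {f f′ g g′} → f S.≈ f′ → g S.≈ g′ → (f S.* g) S.≈ (f′ S.* g′)
  *ˢ-cong p q n = sum-cong-≋ {suc n} λ i → *-cong (p (toℕ i)) (q (n ∸ toℕ i))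

  *ˢ-distribʳ : ∀ h f g → ((f S.+ g) S.* h) S.≈ (f S.* h S.+ g S.* h)
  *ˢ-distribʳ h f g n = trans
    (sum-cong-≋ {suc n} λ i → distribʳ (h (n ∸ toℕ i)) (f (toℕ i)) (g (toℕ i)))
    (∑-distrib-+ {suc n} (λ i → f (toℕ i) * h (n ∸ toℕ i)) (λ i → g (toℕ i) * h (n ∸ toℕ i)))

  *ˢ-distribˡ : ∀ h f g → (h S.* (f S.+ g)) S.≈ (h S.* f S.+ h S.* g)
  *ˢ-distribˡ h f g n = trans
    (sum-cong-≋ {suc n} λ i → distribˡ (h (toℕ i)) (f (n ∸ toℕ i)) (g (n ∸ toℕ i)))
    (∑-distrib-+ {suc n} (λ i → h (toℕ i) * f (n ∸ toℕ i)) (λ i → h (toℕ i) * g (n ∸ toℕ i)))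

  *ˢ-zeroʳ : ∀ f → (f S.* S.0#) S.≈ S.0#
  *ˢ-zeroʳ f n = trans (sum-cong-≋ {suc n} λ i → zeroʳ (f (toℕ i))) (sum-replicate-zero (suc n))

  *ˢ-comm-× : ∀ m f g n → (f S.* (λ n → m × g n)) n ≈ m × (f S.* g) n
  *ˢ-comm-× m f g n = trans
    (sum-cong-≋ {suc n} λ i → ×-comm-* m (f (toℕ i)) (g (n ∸ toℕ i)))
    (sym (×-distrib-sum m {suc n} λ i → f (toℕ i) * g (n ∸ toℕ i)))

  *ˢ-identityˡ : ∀ f → (S.1# S.* f) S.≈ f
  *ˢ-identityˡ f n = begin
    1# * f n + sum {n} _   ≈⟨ +-cong (*-identityˡ (f n)) (zeros n f) ⟩
    f n + 0#               ≈⟨ +-identityʳ (f n) ⟩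
    f n                    ∎
    where
    zeros : ∀ n f → sum {n} (λ i → 0# * f (n ∸ suc (toℕ i))) ≈ 0#
    zeros n f = trans (sum-cong-≋ {n} λ i → zeroˡ _) (sum-replicate-zero n)

  *-assoc-• : ∀ a f g → ((a • f) S.* g) S.≈ (a • (f S.* g))
  *-assoc-• a f g n = begin
    sum {suc n} (λ i → a * f (toℕ i) * g (n ∸ toℕ i))
      ≈⟨ sum-cong-≋ {suc n} (λ i → *-assoc a (f (toℕ i)) (g (n ∸ toℕ i))) ⟩
    sum {suc n} (λ i → a * (f (toℕ i) * g (n ∸ toℕ i)))
      ≈⟨ *-distribˡ-sum {suc n} a (λ i → f (toℕ i) * g (n ∸ toℕ i)) ⟨
    a * (f S.* g) n ∎

  *-comm-• : ∀ a f g → (f S.* (a • g)) S.≈ (a • (f S.* g))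
  *-comm-• a f g n = begin
    sum {suc n} (λ i → f (toℕ i) * (a * g (n ∸ toℕ i)))
      ≈⟨ sum-cong-≋ {suc n} (λ i → Solver.solve 3 (λ a x y → x :* (a :* y) := a :* (x :* y))
           refl a (f (toℕ i)) (g (n ∸ toℕ i))) ⟩
    sum {suc n} (λ i → a * (f (toℕ i) * g (n ∸ toℕ i)))
      ≈⟨ *-distribˡ-sum {suc n} a (λ i → f (toℕ i) * g (n ∸ toℕ i)) ⟨
    a * (f S.* g) n ∎
    where open Solver

  -- Writing f = f₀ + t·s, one has f′ = s + t·s′; the induction is on the
  -- coefficient index, with s in place of f.
  leibniz : ∀ f g → derivative (f S.* g) S.≈ (derivative f S.* g S.+ f S.* derivative g)
  leibniz f g zero = Solver.solve 4
    (λ f₀ f₁ g₀ g₁ → f₀ :* g₁ :+ (f₁ :* g₀ :+ con 0) :+ con 0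
       := ((f₁ :+ con 0) :* g₀ :+ con 0) :+ (f₀ :* (g₁ :+ con 0) :+ con 0))
    refl (f 0) (f 1) (g 0) (g 1)
    where open Solver
  leibniz f g (suc n) = begin
    suc N × (f 0 * g (suc N) + (s S.* g) N)
      ≈⟨ ×-distrib-+ _ _ (suc N) ⟩
    suc N × (f 0 * g (suc N)) + ((s S.* g) N + N × (s S.* g) N)
      ≈⟨ +-cong (sym (×-comm-* (suc N) (f 0) (g (suc N)))) (+-congˡ (leibniz s g n)) ⟩
    f 0 * derivative g N + ((s S.* g) N + ((derivative s S.* g) n + (s S.* derivative g) n))
      ≈⟨ Solver.solve 5 (λ a x₀ x y z → a :+ (x₀ :+ x :+ (y :+ z)) := x₀ :+ (x :+ y) :+ (a :+ z)) refl
           (f 0 * derivative g N) (s 0 * g N) (((λ i → s (suc i)) S.* g) n)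
           ((derivative s S.* g) n) ((s S.* derivative g) n) ⟩
    (s 0 * g N + (((λ i → s (suc i)) S.* g) n + (derivative s S.* g) n)) + (f S.* derivative g) N
      ≈⟨ +-congʳ (+-cong (*-congʳ (sym (×-homo-1 (s 0)))) (sym (*ˢ-distribʳ g (λ i → s (suc i)) (derivative s) n))) ⟩
    (derivative f S.* g) N + (f S.* derivative g) N ∎
    where
    open Solver
    N : ℕ
    N = suc n
    s : Series
    s i = f (suc i)

  [a•f]^k≈a^k•f^k : ∀ a f k → ((a • f) S.^ k) S.≈ ((a ^ k) • (f S.^ k))
  [a•f]^k≈a^k•f^k a f zero    n = sym (*-identityˡ _)
  [a•f]^k≈a^k•f^k a f (suc k) n = begin
    ((a • f) S.* (a • f) S.^ k) n            ≈⟨ *ˢ-cong {a • f} {g = (a • f) S.^ k} (λ _ → refl) ([a•f]^k≈a^k•f^k a f k) n ⟩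
    ((a • f) S.* ((a ^ k) • (f S.^ k))) n    ≈⟨ *-assoc-• a f ((a ^ k) • (f S.^ k)) n ⟩
    a * (f S.* ((a ^ k) • (f S.^ k))) n      ≈⟨ *-congˡ (*-comm-• (a ^ k) f (f S.^ k) n) ⟩
    a * (a ^ k * (f S.* f S.^ k) n)          ≈⟨ *-assoc a _ _ ⟨
    a ^ suc k * (f S.* f S.^ k) n            ∎

  sum-× : ∀ g n → (ℕ.sum (applyUpTo g n)) × 1# ≈ sum {n} (λ i → g (toℕ i) × 1#)
  sum-× g zero    = refl
  sum-× g (suc n) = trans (×-homo-+ 1# (g 0) _) (+-congˡ (sum-× (λ i → g (suc i)) n))

  linearCombination-× : ∀ m s x y f g → m × (s * (x * f + - (y * g))) ≈ s * (x * (m × f) + - (y * (m × g)))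
  linearCombination-× m s x y f g = begin
    m × (s * (x * f + - (y * g)))             ≈⟨ ×-comm-* m s _ ⟨
    s * (m × (x * f + - (y * g)))             ≈⟨ *-congˡ (×-congʳ m (+-congˡ (-‿distribˡ-* y g))) ⟩
    s * (m × (x * f + - y * g))               ≈⟨ *-congˡ (×-distrib-+ (x * f) (- y * g) m) ⟩
    s * (m × (x * f) + m × (- y * g))         ≈⟨ *-congˡ (+-cong (×-comm-* m x f) (×-comm-* m (- y) g)) ⟨
    s * (x * (m × f) + - y * (m × g))         ≈⟨ *-congˡ (+-congˡ (-‿distribˡ-* y (m × g))) ⟨
    s * (x * (m × f) + - (y * (m × g)))       ∎

  -- The two sums share the factor h i, so the combination acts on the other factors alone. Taking
  -- `- y` as a coefficient makes the termwise identity one of commutative semirings.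
  linearCombination-sum : ∀ {l} s x y (f g h : Fin l → Carrier) →
    s * (x * sum (λ i → f i * h i) + - (y * sum (λ i → g i * h i))) ≈
    sum λ i → s * (x * f i + - (y * g i)) * h i
  linearCombination-sum s x y f g h = begin
    s * (x * sum (λ i → f i * h i) + - (y * sum (λ i → g i * h i)))
      ≈⟨ *-congˡ (+-congˡ (-‿distribˡ-* y _)) ⟩
    s * (x * sum (λ i → f i * h i) + - y * sum (λ i → g i * h i))
      ≈⟨ *-congˡ (+-cong (*-distribˡ-sum x (λ i → f i * h i)) (*-distribˡ-sum (- y) (λ i → g i * h i))) ⟩
    s * (sum (λ i → x * (f i * h i)) + sum (λ i → - y * (g i * h i)))
      ≈⟨ *-congˡ (∑-distrib-+ (λ i → x * (f i * h i)) (λ i → - y * (g i * h i))) ⟨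
    s * sum (λ i → x * (f i * h i) + - y * (g i * h i))
      ≈⟨ *-distribˡ-sum s (λ i → x * (f i * h i) + - y * (g i * h i)) ⟩
    sum (λ i → s * (x * (f i * h i) + - y * (g i * h i)))
      ≈⟨ sum-cong-≋ (λ i → Solver.solve 6
           (λ s x y f g h → s :* (x :* (f :* h) :+ y :* (g :* h)) := s :* (x :* f :+ y :* g) :* h)
           refl s x (- y) (f i) (g i) (h i)) ⟩
    sum (λ i → s * (x * f i + - y * g i) * h i)
      ≈⟨ sum-cong-≋ (λ i → *-congʳ (*-congˡ (+-congˡ (-‿distribˡ-* y (g i))))) ⟨
    sum (λ i → s * (x * f i + - (y * g i)) * h i) ∎
    where open Solver

  -- Powers of an exponential series minus one

  module ExponentialSeries (e : Series) (e₀≈1 : e 0 ≈ 1#) (e′≈e : derivative e S.≈ e) where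

    E : Series
    E = e S.- S.1#

    E₀≈0 : E 0 ≈ 0#
    E₀≈0 = trans (+-congʳ e₀≈1) (-‿inverseʳ 1#)

    E′≈E+1 : derivative E S.≈ (E S.+ S.1#)
    E′≈E+1 n = begin
      suc n × (e (suc n) + - 0#)     ≈⟨ ×-congʳ (suc n) (+-congˡ -0#≈0#) ⟩
      suc n × (e (suc n) + 0#)       ≈⟨ ×-congʳ (suc n) (+-identityʳ _) ⟩
      suc n × e (suc n)              ≈⟨ e′≈e n ⟩
      e n                            ≈⟨ +-identityʳ _ ⟨
      e n + 0#                       ≈⟨ +-congˡ (-‿inverseˡ (S.1# n)) ⟨
      e n + (- S.1# n + S.1# n)      ≈⟨ +-assoc _ _ _ ⟨
      e n + - S.1# n + S.1# n        ∎

    [E^1+k]′≈[1+k][E^1+k+E^k] : ∀ k → derivative (E S.^ suc k) S.≈ λ n → suc k × ((E S.^ suc k) n + (E S.^ k) n)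
    [E^1+k]′≈[1+k][E^1+k+E^k] k n = begin
      derivative (E S.* E S.^ k) n
        ≈⟨ leibniz E (E S.^ k) n ⟩
      (derivative E S.* E S.^ k) n + (E S.* derivative (E S.^ k)) n
        ≈⟨ +-cong first (second k n) ⟩
      ((E S.^ suc k) n + (E S.^ k) n) + k × ((E S.^ suc k) n + (E S.^ k) n) ∎
      where
      first : (derivative E S.* E S.^ k) n ≈ (E S.^ suc k) n + (E S.^ k) n
      first = begin
        (derivative E S.* E S.^ k) n             ≈⟨ *ˢ-cong {g = E S.^ k} E′≈E+1 (λ _ → refl) n ⟩
        ((E S.+ S.1#) S.* E S.^ k) n             ≈⟨ *ˢ-distribʳ (E S.^ k) E S.1# n ⟩
        (E S.^ suc k) n + (S.1# S.* E S.^ k) n   ≈⟨ +-congˡ (*ˢ-identityˡ (E S.^ k) n) ⟩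
        (E S.^ suc k) n + (E S.^ k) n            ∎
      -- Multiplied by E, the derivative of the k-th power has a formula without exponent k - 1,
      -- valid at k = 0 as well. It is proved by mutual induction with the enclosing lemma.
      second : ∀ k n → (E S.* derivative (E S.^ k)) n ≈ k × ((E S.^ suc k) n + (E S.^ k) n)
      second zero    n = trans (*ˢ-cong {E} (λ _ → refl) (λ m → ×-zeroʳ (suc m)) n) (*ˢ-zeroʳ E n)
      second (suc k) n = begin
        (E S.* derivative (E S.^ suc k)) n
          ≈⟨ *ˢ-cong {E} (λ _ → refl) ([E^1+k]′≈[1+k][E^1+k+E^k] k) n ⟩
        (E S.* (λ n → suc k × (E S.^ suc k S.+ E S.^ k) n)) n
          ≈⟨ *ˢ-comm-× (suc k) E (E S.^ suc k S.+ E S.^ k) n ⟩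
        suc k × (E S.* (E S.^ suc k S.+ E S.^ k)) n
          ≈⟨ ×-congʳ (suc k) (*ˢ-distribˡ E (E S.^ suc k) (E S.^ k) n) ⟩
        suc k × ((E S.^ suc (suc k)) n + (E S.^ suc k) n) ∎

    -- The ring need not contain 1/k!; the differential equation still determines the coefficients
    -- in this multiplied form.
    k!×e : ∀ k → (k !) × e k ≈ 1#
    k!×e zero    = trans (×-homo-1 _) e₀≈1
    k!×e (suc k) = begin
      (suc k ℕ.* k !) × e (suc k)    ≈⟨ ×-congˡ (ℕ.*-comm (suc k) (k !)) ⟩
      (k ! ℕ.* suc k) × e (suc k)    ≈⟨ ×-assocˡ (e (suc k)) (k !) (suc k) ⟨
      (k !) × (suc k × e (suc k))    ≈⟨ ×-congʳ (k !) (e′≈e k) ⟩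
      (k !) × e k                    ≈⟨ k!×e k ⟩
      1#                             ∎

    -- The number k! S(n,k) counts the surjections from an n-set onto a k-set; k! is kept on the
    -- right to avoid dividing by it. In the inductive step the differential equation for the powers
    -- of E, multiplied by n!, becomes the Stirling recurrence.
    n!×E^k : ∀ n k → (n !) × (E S.^ k) n ≈ (k ! ℕ.* stirling₂ n k) × 1#
    n!×E^k zero    zero    = refl
    n!×E^k zero    (suc k) = begin
      1 × (E 0 * (E S.^ k) 0 + 0#)   ≈⟨ ×-homo-1 _ ⟩
      E 0 * (E S.^ k) 0 + 0#         ≈⟨ +-identityʳ _ ⟩
      E 0 * (E S.^ k) 0              ≈⟨ *-congʳ E₀≈0 ⟩
      0# * (E S.^ k) 0               ≈⟨ zeroˡ _ ⟩
      0#                             ≈⟨ ×-congˡ (ℕ.*-zeroʳ (suc k !)) ⟨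
      (suc k ! ℕ.* 0) × 1#           ∎
    n!×E^k (suc n) zero    = ×-zeroʳ (suc n !)
    n!×E^k (suc n) (suc k) = begin
      (suc n ℕ.* n !) × x (suc n)
        ≈⟨ ×-congˡ (ℕ.*-comm (suc n) (n !)) ⟩
      (n ! ℕ.* suc n) × x (suc n)
        ≈⟨ ×-assocˡ (x (suc n)) (n !) (suc n) ⟨
      (n !) × (suc n × x (suc n))
        ≈⟨ ×-congʳ (n !) ([E^1+k]′≈[1+k][E^1+k+E^k] k n) ⟩
      (n !) × (suc k × (x n + y n))
        ≈⟨ ×-assocˡ _ (n !) (suc k) ⟩
      (n ! ℕ.* suc k) × (x n + y n)
        ≈⟨ ×-congˡ (ℕ.*-comm (n !) (suc k)) ⟩
      (suc k ℕ.* n !) × (x n + y n)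
        ≈⟨ ×-assocˡ _ (suc k) (n !) ⟨
      suc k × ((n !) × (x n + y n))
        ≈⟨ ×-congʳ (suc k) (×-distrib-+ _ _ (n !)) ⟩
      suc k × ((n !) × x n + (n !) × y n)
        ≈⟨ ×-congʳ (suc k) (+-cong (n!×E^k n (suc k)) (n!×E^k n k)) ⟩
      suc k × ((suc k ! ℕ.* a) × 1# + (k ! ℕ.* b) × 1#)
        ≈⟨ ×-congʳ (suc k) (×-homo-+ 1# (suc k ! ℕ.* a) (k ! ℕ.* b)) ⟨
      suc k × ((suc k ! ℕ.* a ℕ.+ k ! ℕ.* b) × 1#)
        ≈⟨ ×-assocˡ 1# (suc k) (suc k ! ℕ.* a ℕ.+ k ! ℕ.* b) ⟩
      (suc k ℕ.* (suc k ! ℕ.* a ℕ.+ k ! ℕ.* b)) × 1#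
        ≈⟨ ×-congˡ (ℕ-solve (suc k) (k !) a b) ⟩
      (suc k ! ℕ.* stirling₂ (suc n) (suc k)) × 1# ∎
      where
      x y : Series
      x = E S.^ suc k
      y = E S.^ k
      a b : ℕ
      a = stirling₂ n (suc k)
      b = stirling₂ n k
      ℕ-solve : ∀ m p a b → m ℕ.* (m ℕ.* p ℕ.* a ℕ.+ p ℕ.* b) ≡ m ℕ.* p ℕ.* (m ℕ.* a ℕ.+ b)
      ℕ-solve = solve-∀

    -- The factor k! that `n!×E^k` leaves in the k-th term is absorbed by the coefficient e k, by
    -- `k!×e`.
    n!×e⟨a•E⟩ : ∀ a n → (n !) × (e ⟨ a • E ⟩) n ≈ sum {suc n} (λ k → a ^ toℕ k * (stirling₂ n (toℕ k) × 1#))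
    n!×e⟨a•E⟩ a n = begin
      (n !) × sum {suc n} (λ k → e (toℕ k) * ((a • E) S.^ toℕ k) n)
        ≈⟨ ×-distrib-sum (n !) {suc n} (λ k → e (toℕ k) * ((a • E) S.^ toℕ k) n) ⟩
      sum {suc n} (λ k → (n !) × (e (toℕ k) * ((a • E) S.^ toℕ k) n))
        ≈⟨ sum-cong-≋ {suc n} (λ k → term (toℕ k)) ⟩
      sum {suc n} (λ k → a ^ toℕ k * (stirling₂ n (toℕ k) × 1#)) ∎
      where
      term : ∀ k → (n !) × (e k * ((a • E) S.^ k) n) ≈ a ^ k * (stirling₂ n k × 1#)
      term k = begin
        (n !) × (e k * ((a • E) S.^ k) n)
          ≈⟨ ×-congʳ (n !) (*-congˡ ([a•f]^k≈a^k•f^k a E k n)) ⟩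
        (n !) × (e k * (a ^ k * (E S.^ k) n))
          ≈⟨ ×-congʳ (n !) (Solver.solve 3 (λ e a x → e :* (a :* x) := e :* a :* x) refl _ _ _) ⟩
        (n !) × (e k * a ^ k * (E S.^ k) n)
          ≈⟨ ×-comm-* (n !) _ _ ⟨
        e k * a ^ k * ((n !) × (E S.^ k) n)
          ≈⟨ *-congˡ (n!×E^k n k) ⟩
        e k * a ^ k * ((k ! ℕ.* stirling₂ n k) × 1#)
          ≈⟨ *-congˡ (×-assocˡ 1# (k !) (stirling₂ n k)) ⟨
        e k * a ^ k * ((k !) × (stirling₂ n k × 1#))
          ≈⟨ ×-comm-* (k !) _ _ ⟩
        (k !) × (e k * a ^ k * (stirling₂ n k × 1#))
          ≈⟨ ×-congʳ (k !) (*-assoc _ _ _) ⟩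
        (k !) × (e k * (a ^ k * (stirling₂ n k × 1#)))
          ≈⟨ ×-assoc-* (k !) _ _ ⟨
        ((k !) × e k) * (a ^ k * (stirling₂ n k × 1#))
          ≈⟨ *-congʳ (k!×e k) ⟩
        1# * (a ^ k * (stirling₂ n k × 1#))
          ≈⟨ *-identityˡ _ ⟩
        a ^ k * (stirling₂ n k × 1#) ∎
        where open Solver

-- The field ℚ(√5)

open import Defs using
  ( ℚ√5; _+√5·_; ℚ√5-rawRing; fromℚ; 1/√5; α; β; _•_; _⟨_⟩; egf; exp )
  renaming (_≈_ to _≈ˢ_; _-_ to _-ˢ_)

open ≡ using (refl; sym; trans)

private
  module R = RawRing ℚ√5-rawRing

ℚ√5-isCommutativeRing : IsCommutativeRing _≡_ R._+_ R._*_ R.-_ R.0# R.1#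
ℚ√5-isCommutativeRing = record
  { isRing = record
    { +-isAbelianGroup = record
      { isGroup = record
        { isMonoid = record
          { isSemigroup = record
            { isMagma = isMagma R._+_
            ; assoc   = λ (a +√5· b) (c +√5· d) (e +√5· f) → cong₂ _+√5·_ (ℚ.+-assoc a c e) (ℚ.+-assoc b d f)
            }
          ; identity = comm∧idˡ⇒id +-comm λ (a +√5· b) → cong₂ _+√5·_ (ℚ.+-identityˡ a) (ℚ.+-identityˡ b)
          }
        ; inverse = comm∧invˡ⇒inv +-comm λ (a +√5· b) → cong₂ _+√5·_ (ℚ.+-inverseˡ a) (ℚ.+-inverseˡ b)
        ; ⁻¹-cong = cong R.-_
        }
      ; comm = +-comm
      }
    ; *-cong     = cong₂ R._*_
    ; *-assoc    = λ (a +√5· b) (c +√5· d) (e +√5· f) → cong₂ _+√5·_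
        (solve 7 (λ q a b c d e f →
            (a :* c :+ q :* (b :* d)) :* e :+ q :* ((a :* d :+ b :* c) :* f)
            := a :* (c :* e :+ q :* (d :* f)) :+ q :* (b :* (c :* f :+ d :* e)))
          refl five a b c d e f)
        (solve 7 (λ q a b c d e f →
            (a :* c :+ q :* (b :* d)) :* f :+ (a :* d :+ b :* c) :* e
            := a :* (c :* f :+ d :* e) :+ b :* (c :* e :+ q :* (d :* f)))
          refl five a b c d e f)
    ; *-identity = comm∧idˡ⇒id *-comm λ (a +√5· b) → cong₂ _+√5·_
        (solve 3 (λ q a b → con 1ℚ :* a :+ q :* (con 0ℚ :* b) := a) refl five a b)
        (solve 2 (λ a b → con 1ℚ :* b :+ con 0ℚ :* a := b) refl a b)
    ; distrib    = comm∧distrˡ⇒distr (cong₂ R._+_) *-comm λ (a +√5· b) (c +√5· d) (e +√5· f) → cong₂ _+√5·_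
        (solve 7 (λ q a b c d e f →
            a :* (c :+ e) :+ q :* (b :* (d :+ f))
            := (a :* c :+ q :* (b :* d)) :+ (a :* e :+ q :* (b :* f)))
          refl five a b c d e f)
        (solve 6 (λ a b c d e f →
            a :* (d :+ f) :+ b :* (c :+ e)
            := (a :* d :+ b :* c) :+ (a :* f :+ b :* e))
          refl a b c d e f)
    }
  ; *-comm = *-comm
  }
  where
  open ℚ.+-*-Solver
  five : ℚ
  five = + 5 ℚ./ 1
  +-comm : Commutative _≡_ R._+_
  +-comm (a +√5· b) (c +√5· d) = cong₂ _+√5·_ (ℚ.+-comm a c) (ℚ.+-comm b d)
  *-comm : Commutative _≡_ R._*_
  *-comm (a +√5· b) (c +√5· d) = cong₂ _+√5·_
    (solve 5 (λ q a b c d → a :* c :+ q :* (b :* d) := c :* a :+ q :* (d :* b)) refl five a b c d)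
    (solve 4 (λ a b c d → a :* d :+ b :* c := c :* b :+ d :* a) refl a b c d)

ℚ√5-commutativeRing : CommutativeRing _ _
ℚ√5-commutativeRing = record { isCommutativeRing = ℚ√5-isCommutativeRing }

-- Fractions in ℚ are reduced by a gcd that does not compute for variable a and m. Among
-- unnormalised rationals the claim is a cross-multiplication of integers.
m*[a/m]≡a : ∀ a m .{{_ : ℕ.NonZero m}} → (+ m ℚ./ 1) ℚ.* (+ a ℚ./ m) ≡ + a ℚ./ 1
m*[a/m]≡a a m@(suc d) = ℚ.toℚᵘ-injective (begin
  ℚ.toℚᵘ ((+ m ℚ./ 1) ℚ.* (+ a ℚ./ m))
    ≈⟨ ℚ.toℚᵘ-homo-* (+ m ℚ./ 1) (+ a ℚ./ m) ⟩
  ℚ.toℚᵘ (+ m ℚ./ 1) ℚᵘ.* ℚ.toℚᵘ (+ a ℚ./ m)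
    ≈⟨ ℚᵘ.*-cong (ℚ.toℚᵘ-fromℚᵘ (ℚᵘ.mkℚᵘ (+ m) 0)) (ℚ.toℚᵘ-fromℚᵘ (ℚᵘ.mkℚᵘ (+ a) d)) ⟩
  ℚᵘ.mkℚᵘ (+ m) 0 ℚᵘ.* ℚᵘ.mkℚᵘ (+ a) d
    ≈⟨ ℚᵘ.*≡* (cong₂ ℤ._*_ (ℤ.*-comm (+ m) (+ a)) refl ■ (ℤ.*-assoc (+ a) (+ m) (+ 1) ■ cong (+ a ℤ.*_) (ℤ.*-comm (+ m) (+ 1)))) ⟩
  ℚᵘ.mkℚᵘ (+ a) 0
    ≈⟨ ℚ.toℚᵘ-fromℚᵘ (ℚᵘ.mkℚᵘ (+ a) 0) ⟨
  ℚ.toℚᵘ (+ a ℚ./ 1) ∎)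
  where
  open ℚᵘ.≃-Reasoning
  infixr 5 _■_
  _■_ = trans

[1+a]/1≡1+a/1 : ∀ a → + suc a ℚ./ 1 ≡ 1ℚ ℚ.+ (+ a ℚ./ 1)
[1+a]/1≡1+a/1 a = ℚ.toℚᵘ-injective (begin
  ℚ.toℚᵘ (+ suc a ℚ./ 1)
    ≈⟨ ℚ.toℚᵘ-fromℚᵘ (ℚᵘ.mkℚᵘ (+ suc a) 0) ⟩
  ℚᵘ.mkℚᵘ (+ suc a) 0
    ≈⟨ ℚᵘ.*≡* (cong (λ x → (+ 1 ℤ.+ x) ℤ.* + 1) (sym (ℤ.*-identityʳ (+ a)))) ⟩
  ℚᵘ.1ℚᵘ ℚᵘ.+ ℚᵘ.mkℚᵘ (+ a) 0
    ≈⟨ ℚᵘ.+-congʳ ℚᵘ.1ℚᵘ (ℚ.toℚᵘ-fromℚᵘ (ℚᵘ.mkℚᵘ (+ a) 0)) ⟨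
  ℚᵘ.1ℚᵘ ℚᵘ.+ ℚ.toℚᵘ (+ a ℚ./ 1)
    ≈⟨ ℚ.toℚᵘ-homo-+ 1ℚ (+ a ℚ./ 1) ⟨
  ℚ.toℚᵘ (1ℚ ℚ.+ (+ a ℚ./ 1)) ∎)
  where open ℚᵘ.≃-Reasoning

fromℚ-* : ∀ p q → fromℚ p R.* fromℚ q ≡ fromℚ (p ℚ.* q)
fromℚ-* p q = cong₂ _+√5·_
  (solve 3 (λ f p q → p :* q :+ f :* (con 0ℚ :* con 0ℚ) := p :* q) refl (+ 5 ℚ./ 1) p q)
  (solve 2 (λ p q → p :* con 0ℚ :+ con 0ℚ :* q := con 0ℚ) refl p q)
  where open ℚ.+-*-Solver

module _ where
  open CommutativeRing ℚ√5-commutativeRing hiding (refl; sym; trans)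
  open Algebra.Properties.Monoid.Sum +-monoid using (sum; sum-cong-≋)
  open Algebra.Properties.Semiring.Mult semiring
  open Algebra.Properties.Semiring.Exp semiring using () renaming (_^_ to _↑_)
  open Algebra.Properties.Ring ring using (-‿+-comm)
  open PowerSeriesProperties ℚ√5-commutativeRing
  open Algebra.Solver.Ring.NaturalCoefficients.Default commutativeSemiring
  open ≡-Reasoning

  ×1≡fromℚ : ∀ n → n × 1# ≡ fromℚ (+ n ℚ./ 1)
  ×1≡fromℚ zero    = refl
  ×1≡fromℚ (suc n) = begin
    1# + n × 1#                 ≡⟨ cong (_+_ 1#) (×1≡fromℚ n) ⟩
    1# + fromℚ (+ n ℚ./ 1)      ≡⟨ cong fromℚ ([1+a]/1≡1+a/1 n) ⟨
    fromℚ (+ suc n ℚ./ 1)       ∎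

  m×[a/m]≡a×1 : ∀ a m .{{_ : ℕ.NonZero m}} → m × fromℚ (+ a ℚ./ m) ≡ a × 1#
  m×[a/m]≡a×1 a m = begin
    m × fromℚ (+ a ℚ./ m)                   ≡⟨ cong (m ×_) (*-identityˡ _) ⟨
    m × (1# * fromℚ (+ a ℚ./ m))            ≡⟨ ×-assoc-* m _ _ ⟨
    (m × 1#) * fromℚ (+ a ℚ./ m)            ≡⟨ cong (_* fromℚ (+ a ℚ./ m)) (×1≡fromℚ m) ⟩
    fromℚ (+ m ℚ./ 1) * fromℚ (+ a ℚ./ m)   ≡⟨ fromℚ-* (+ m ℚ./ 1) (+ a ℚ./ m) ⟩
    fromℚ ((+ m ℚ./ 1) ℚ.* (+ a ℚ./ m))     ≡⟨ cong fromℚ (m*[a/m]≡a a m) ⟩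
    fromℚ (+ a ℚ./ 1)                       ≡⟨ ×1≡fromℚ a ⟨
    a × 1#                                  ∎

  -- Multiplication by 1/m undoes `m ×_`, so coefficients may be compared after scaling by n!.
  ×-cancelˡ : ∀ m .{{_ : ℕ.NonZero m}} {x y} → m × x ≡ m × y → x ≡ y
  ×-cancelˡ m {x} {y} eq = trans (sym (retract x)) (trans (cong (fromℚ (+ 1 ℚ./ m) *_) eq) (retract y))
    where
    retract : ∀ x → fromℚ (+ 1 ℚ./ m) * (m × x) ≡ x
    retract x = begin
      fromℚ (+ 1 ℚ./ m) * (m × x)   ≡⟨ ×-comm-* m (fromℚ (+ 1 ℚ./ m)) x ⟩
      m × (fromℚ (+ 1 ℚ./ m) * x)   ≡⟨ ×-assoc-* m (fromℚ (+ 1 ℚ./ m)) x ⟨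
      (m × fromℚ (+ 1 ℚ./ m)) * x   ≡⟨ cong (_* x) (m×[a/m]≡a×1 1 m) ⟩
      (1 × 1#) * x                  ≡⟨ cong (_* x) (×-homo-1 1#) ⟩
      1# * x                        ≡⟨ *-identityˡ x ⟩
      x                             ∎

  n!×egf : ∀ a n → (n !) × egf a n ≡ a n × 1#
  n!×egf a n = m×[a/m]≡a×1 (a n) (n !)
    where instance _ = n ℕ.!≢0

  exp′≈exp : derivative exp ≈ˢ exp
  exp′≈exp n = ×-cancelˡ (n !) (begin
    (n !) × (suc n × exp (suc n))   ≡⟨ ×-assocˡ _ (n !) (suc n) ⟩
    (n ! ℕ.* suc n) × exp (suc n)   ≡⟨ cong (_× exp (suc n)) (ℕ.*-comm (n !) (suc n)) ⟩
    (suc n !) × exp (suc n)         ≡⟨ n!×egf (λ _ → 1) (suc n) ⟩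
    1 × 1#                          ≡⟨ n!×egf (λ _ → 1) n ⟨
    (n !) × exp n                   ∎)
    where instance _ = n ℕ.!≢0

  -- Binet's formula and the generating function

  open ExponentialSeries exp refl exp′≈exp

  -- The exponent is k + 1 because `fib` starts at F₁. Since α and β are roots of x² = x + 1, both
  -- sides obey the Fibonacci recurrence; the initial values are computed in ℚ(√5).
  binet : ∀ k → 1/√5 * (α * α ↑ k + - (β * β ↑ k)) ≡ fib k × 1#
  binet zero          = refl
  binet (suc zero)    = refl
  binet (suc (suc k)) = begin
    1/√5 * (α * (α * (α * a)) + - (β * (β * (β * b))))
      -- Each `refl` verifies x² = x + 1 by evaluating rational numbers.
      ≡⟨ cong₂ (λ x y → 1/√5 * (x + - y)) (quadratic α a refl) (quadratic β b refl) ⟩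
    1/√5 * ((α * (α * a) + α * a) + - (β * (β * b) + β * b))
      ≡⟨ cong (λ x → 1/√5 * ((α * (α * a) + α * a) + x)) (-‿+-comm (β * (β * b)) (β * b)) ⟨
    1/√5 * ((α * (α * a) + α * a) + (- (β * (β * b)) + - (β * b)))
      ≡⟨ solve 5 (λ s x y z w → s :* (x :+ y :+ (z :+ w)) := s :* (x :+ z) :+ s :* (y :+ w)) refl
           1/√5 (α * (α * a)) (α * a) (- (β * (β * b))) (- (β * b)) ⟩
    1/√5 * (α * (α * a) + - (β * (β * b))) + 1/√5 * (α * a + - (β * b))
      ≡⟨ cong₂ _+_ (binet (suc k)) (binet k) ⟩
    fib (suc k) × 1# + fib k × 1#
      ≡⟨ ×-homo-+ 1# (fib (suc k)) (fib k) ⟨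
    fib (suc (suc k)) × 1# ∎
    where
    a b : ℚ√5
    a = α ↑ k
    b = β ↑ k
    quadratic : ∀ x y → x * x ≡ x + 1# → x * (x * (x * y)) ≡ x * (x * y) + x * y
    quadratic x y x²≡x+1 = begin
      x * (x * (x * y))     ≡⟨ solve 2 (λ x y → x :* (x :* (x :* y)) := x :* x :* (x :* y)) refl x y ⟩
      x * x * (x * y)       ≡⟨ cong (_* (x * y)) x²≡x+1 ⟩
      (x + 1#) * (x * y)    ≡⟨ solve 2 (λ x y → (x :+ con 1) :* (x :* y) := x :* (x :* y) :+ x :* y) refl x y ⟩
      x * (x * y) + x * y   ∎

  -- Both exponentials expand with the same Stirling numbers, so the linear combination reaches the
  -- powers of α and β term by term, where Binet's formula applies.
  n!×binetSeries : ∀ n → (n !) × ((1/√5 • (α • exp ⟨ α • E ⟩ -ˢ β • exp ⟨ β • E ⟩)) n) ≡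
    (ℕ.sum (applyUpTo (λ k → stirling₂ n k ℕ.* fib k) (suc n))) × 1#
  n!×binetSeries n = begin
    (n !) × (1/√5 * (α * (exp ⟨ α • E ⟩) n + - (β * (exp ⟨ β • E ⟩) n)))
      ≡⟨ linearCombination-× (n !) 1/√5 α β ((exp ⟨ α • E ⟩) n) ((exp ⟨ β • E ⟩) n) ⟩
    1/√5 * (α * ((n !) × (exp ⟨ α • E ⟩) n) + - (β * ((n !) × (exp ⟨ β • E ⟩) n)))
      ≡⟨ cong₂ (λ x y → 1/√5 * (α * x + - (β * y))) (n!×e⟨a•E⟩ α n) (n!×e⟨a•E⟩ β n) ⟩
    1/√5 * (α * sum {suc n} (λ k → α ↑ toℕ k * S k) + - (β * sum {suc n} (λ k → β ↑ toℕ k * S k)))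
      ≡⟨ linearCombination-sum {suc n} 1/√5 α β (λ k → α ↑ toℕ k) (λ k → β ↑ toℕ k) S ⟩
    sum {suc n} (λ k → 1/√5 * (α * α ↑ toℕ k + - (β * β ↑ toℕ k)) * S k)
      ≡⟨ sum-cong-≋ {suc n} (λ k → cong (_* S k) (binet (toℕ k))) ⟩
    sum {suc n} (λ k → (fib (toℕ k) × 1#) * S k)
      ≡⟨ sum-cong-≋ {suc n} (λ k → *-comm (fib (toℕ k) × 1#) (S k)) ⟩
    sum {suc n} (λ k → S k * (fib (toℕ k) × 1#))
      ≡⟨ sum-cong-≋ {suc n} (λ k → ×1-homo-* (stirling₂ n (toℕ k)) (fib (toℕ k))) ⟨
    sum {suc n} (λ k → (stirling₂ n (toℕ k) ℕ.* fib (toℕ k)) × 1#)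
      ≡⟨ sum-× (λ k → stirling₂ n k ℕ.* fib k) (suc n) ⟨
    (ℕ.sum (applyUpTo (λ k → stirling₂ n k ℕ.* fib k) (suc n))) × 1# ∎
    where
    S : Fin (suc n) → ℚ√5
    S k = stirling₂ n (toℕ k) × 1#

  fibonacciFubini-egf : egf fibonacciFubini ≈ˢ (1/√5 • (α • exp ⟨ α • E ⟩ -ˢ β • exp ⟨ β • E ⟩))
  fibonacciFubini-egf n = ×-cancelˡ (n !) (begin
    (n !) × egf fibonacciFubini n
      ≡⟨ n!×egf fibonacciFubini n ⟩
    fibonacciFubini n × 1#
      ≡⟨ cong (_× 1#) (fibonacciFubini≡Σ n) ⟩
    (ℕ.sum (applyUpTo (λ k → stirling₂ n k ℕ.* fib k) (suc n))) × 1#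
      ≡⟨ n!×binetSeries n ⟨
    (n !) × ((1/√5 • (α • exp ⟨ α • E ⟩ -ˢ β • exp ⟨ β • E ⟩)) n) ∎)
    where instance _ = n ℕ.!≢0

open import Defs

theorem3 : egf fibonacciFubini ≈ 1/√5 • (α • exp ⟨ α • (exp - 1#) ⟩ - β • exp ⟨ β • (exp - 1#) ⟩)
theorem3 = fibonacciFubini-egf
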